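{- For every integer $k>0$ there exists a constant $c_k$ such that every graph $G$ of treewidth at most $k$ has rectilinear crossing number $\overline{\mathrm{cr}}(G)\leq c_k\cdot\Delta(G)\cdot|G|$, where $\Delta(G)$ is the maximum degree of $G$ and $|G|$ its number of vertices.
   Context: Graphs are undirected, simple and finite; $|G|=|V(G)|$. A rectilinear drawing of $G$ represents the vertices by distinct points of the plane in general position (no three on a line, and no three segments between pairs of these points meet in one point unless all three share a common endpoint) and each edge by the straight line-segment between its endpoints. A crossing is a point of intersection of two edges other than a common endpoint. The rectilinear crossing number $\overline{\mathrm{cr}}(G)$ is the minimum number of crossings in any rectilinear drawing of $G$. Treewidth is the usual one: the minimum, over tree decompositions, of the maximum bag size minus $1$. -}

module Defs where

open import Data.Nat.Base as ℕ using (ℕ; _∸_; _⊔_)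
import Data.Nat.Properties as ℕ
open import Data.Fin.Base using (Fin; zero; suc; inject₁; fromℕ)
open import Data.Fin.Subset using (Subset; _∈_; ∣_∣)
open import Data.List.Base using (length; filter; allFin)
open import Data.Product.Base using (Σ; ∃; ∃-syntax; _×_; _,_; proj₁; proj₂)
open import Data.Rational.Base as ℚ using (ℚ; 0ℚ; 1ℚ)
import Data.Rational.Properties as ℚ
open import Data.Rational.Solver using (module +-*-Solver)
open import Data.Sum.Base using (_⊎_)
import Data.Vec.Functional as Vector
open import Function.Definitions using (Injective)
open import Level using (0ℓ)
open import Relation.Binary.Construct.Closure.ReflexiveTransitive using (Star)
open import Relation.Binary.Core using (Rel)
open import Relation.Binary.Definitions using (Decidable; Symmetric)
open import Relation.Binary.PropositionalEquality
  using (_≡_; _≢_; refl; sym; trans; cong; cong₂; subst)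
open import Relation.Nullary.Negation.Core using (¬_)

------------------------------------------------------------------------
-- Real numbers, as Cauchy sequences of rationals with a modulus

dist : ℚ → ℚ → ℚ
dist p q = ℚ.∣ p ℚ.- q ∣

IsCauchy : (ℕ → ℚ) → Set
IsCauchy x = ∀ ε → 0ℚ ℚ.< ε →
  ∃[ N ] ∀ m n → N ℕ.≤ m → N ℕ.≤ n → dist (x m) (x n) ℚ.< ε

record ℝ : Set where
  constructor mkℝ
  field
    seq    : ℕ → ℚ
    cauchy : IsCauchy seq

open ℝ public

infix 4 _≈_ _≤_

record _≈_ (x y : ℝ) : Set where
  constructor mk≈
  field
    eventually-close : ∀ ε → 0ℚ ℚ.< ε →
      ∃[ N ] ∀ n → N ℕ.≤ n → dist (seq x n) (seq y n) ℚ.< ε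

record _≤_ (x y : ℝ) : Set where
  constructor mk≤
  field
    eventually-below : ∀ ε → 0ℚ ℚ.< ε →
      ∃[ N ] ∀ n → N ℕ.≤ n → seq x n ℚ.< seq y n ℚ.+ ε

open _≈_ public
open _≤_ public

fromℚ : ℚ → ℝ
fromℚ q = mkℝ (λ _ → q) λ ε 0<ε → 0 , λ _ _ _ _ →
  subst (λ z → ℚ.∣ z ∣ ℚ.< ε) (sym (ℚ.+-inverseʳ q)) 0<ε

0ℝ 1ℝ : ℝ
0ℝ = fromℚ 0ℚ
1ℝ = fromℚ 1ℚ

dist-+ : ∀ a b c d → dist (a ℚ.+ b) (c ℚ.+ d) ℚ.≤ dist a c ℚ.+ dist b d
dist-+ a b c d = subst (λ z → ℚ.∣ z ∣ ℚ.≤ dist a c ℚ.+ dist b d)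
  (solve 4 (λ a b c d → (a :- c) :+ (b :- d) := (a :+ b) :- (c :+ d)) refl a b c d)
  (ℚ.∣p+q∣≤∣p∣+∣q∣ (a ℚ.- c) (b ℚ.- d))
  where open +-*-Solver

dist-neg : ∀ a b → dist (ℚ.- a) (ℚ.- b) ≡ dist a b
dist-neg a b = trans
  (cong ℚ.∣_∣ (solve 2 (λ a b → (:- a) :- (:- b) := :- (a :- b)) refl a b))
  (ℚ.∣-p∣≡∣p∣ (a ℚ.- b))
  where open +-*-Solver

dist-* : ∀ a b c d →
  dist (a ℚ.* b) (c ℚ.* d) ℚ.≤ ℚ.∣ a ∣ ℚ.* dist b d ℚ.+ ℚ.∣ d ∣ ℚ.* dist a c
dist-* a b c d = begin
  ℚ.∣ a ℚ.* b ℚ.- c ℚ.* d ∣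
    ≡⟨ cong ℚ.∣_∣ (solve 4 (λ a b c d →
         a :* b :- c :* d := a :* (b :- d) :+ d :* (a :- c)) refl a b c d) ⟩
  ℚ.∣ a ℚ.* (b ℚ.- d) ℚ.+ d ℚ.* (a ℚ.- c) ∣
    ≤⟨ ℚ.∣p+q∣≤∣p∣+∣q∣ (a ℚ.* (b ℚ.- d)) (d ℚ.* (a ℚ.- c)) ⟩
  ℚ.∣ a ℚ.* (b ℚ.- d) ∣ ℚ.+ ℚ.∣ d ℚ.* (a ℚ.- c) ∣
    ≡⟨ cong (ℚ._+ ℚ.∣ d ℚ.* (a ℚ.- c) ∣) (ℚ.∣p*q∣≡∣p∣*∣q∣ a (b ℚ.- d)) ⟩
  ℚ.∣ a ∣ ℚ.* dist b d ℚ.+ ℚ.∣ d ℚ.* (a ℚ.- c) ∣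
    ≡⟨ cong (ℚ.∣ a ∣ ℚ.* dist b d ℚ.+_) (ℚ.∣p*q∣≡∣p∣*∣q∣ d (a ℚ.- c)) ⟩
  ℚ.∣ a ∣ ℚ.* dist b d ℚ.+ ℚ.∣ d ∣ ℚ.* dist a c ∎
  where
  open ℚ.≤-Reasoning
  open +-*-Solver

½*+½* : ∀ ε → ℚ.½ ℚ.* ε ℚ.+ ℚ.½ ℚ.* ε ≡ ε
½*+½* ε = trans (sym (ℚ.*-distribʳ-+ ε ℚ.½ ℚ.½)) (ℚ.*-identityˡ ε)

0<½* : ∀ {ε} → 0ℚ ℚ.< ε → 0ℚ ℚ.< ℚ.½ ℚ.* ε
0<½* {ε} 0<ε = ℚ.*-monoʳ-<-pos ℚ.½ {0ℚ} {ε} 0<ε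

cauchy-bound : ∀ {x} → IsCauchy x →
  ∃[ B ] 0ℚ ℚ.< B × ∃[ N ] ∀ n → N ℕ.≤ n → ℚ.∣ x n ∣ ℚ.< B
cauchy-bound {x} cx with cx 1ℚ (ℚ.positive⁻¹ 1ℚ)
... | N , close = 1ℚ ℚ.+ ℚ.∣ x N ∣ , 0<B , N , bound
  where
  0<B : 0ℚ ℚ.< 1ℚ ℚ.+ ℚ.∣ x N ∣
  0<B = ℚ.+-mono-<-≤ {0ℚ} {1ℚ} {0ℚ} {ℚ.∣ x N ∣} (ℚ.positive⁻¹ 1ℚ) (ℚ.0≤∣p∣ (x N))
  bound : ∀ n → N ℕ.≤ n → ℚ.∣ x n ∣ ℚ.< 1ℚ ℚ.+ ℚ.∣ x N ∣
  bound n N≤n = ℚ.≤-<-trans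
    (subst (λ z → ℚ.∣ z ∣ ℚ.≤ dist (x n) (x N) ℚ.+ ℚ.∣ x N ∣)
      (solve 2 (λ a b → (a :- b) :+ b := a) refl (x n) (x N))
      (ℚ.∣p+q∣≤∣p∣+∣q∣ (x n ℚ.- x N) (x N)))
    (ℚ.+-monoˡ-< ℚ.∣ x N ∣ {dist (x n) (x N)} {1ℚ} (close n N N≤n ℕ.≤-refl))
    where open +-*-Solver

-- For a bound B > 0, any ε > 0 has a δ > 0 with B δ = ε.
divide : ∀ B ε → 0ℚ ℚ.< B → 0ℚ ℚ.< ε → ∃[ δ ] 0ℚ ℚ.< δ × B ℚ.* δ ≡ ε
divide B ε 0<B 0<ε = ℚ.1/ B ℚ.* ε , 0<δ , eq
  where
  instance
    B-pos : ℚ.Positive B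
    B-pos = ℚ.positive 0<B
    B-nonZero : ℚ.NonZero B
    B-nonZero = ℚ.pos⇒nonZero B
    ε-pos : ℚ.Positive ε
    ε-pos = ℚ.positive 0<ε
    1/B-pos : ℚ.Positive (ℚ.1/ B)
    1/B-pos = ℚ.1/pos⇒pos B
  0<δ : 0ℚ ℚ.< ℚ.1/ B ℚ.* ε
  0<δ = ℚ.positive⁻¹ _ {{ℚ.pos*pos⇒pos (ℚ.1/ B) ε}}
  eq : B ℚ.* (ℚ.1/ B ℚ.* ε) ≡ ε
  eq = trans (sym (ℚ.*-assoc B (ℚ.1/ B) ε))
    (trans (cong (ℚ._* ε) (ℚ.*-inverseʳ B)) (ℚ.*-identityˡ ε))

≤-*-< : ∀ {p q B δ} → ℚ.∣ p ∣ ℚ.< B → 0ℚ ℚ.< B → ℚ.∣ q ∣ ℚ.< δ →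
  ℚ.∣ p ∣ ℚ.* ℚ.∣ q ∣ ℚ.< B ℚ.* δ
≤-*-< {p} {q} {B} {δ} p<B 0<B q<δ = ℚ.≤-<-trans
  (ℚ.*-monoʳ-≤-nonNeg ℚ.∣ q ∣ {{ℚ.nonNegative (ℚ.0≤∣p∣ q)}} {ℚ.∣ p ∣} {B} (ℚ.<⇒≤ p<B))
  (ℚ.*-monoʳ-<-pos B {{ℚ.positive 0<B}} {ℚ.∣ q ∣} {δ} q<δ)

*-close : ∀ {a b c d B C β γ ε} → 0ℚ ℚ.< B → 0ℚ ℚ.< C →
  B ℚ.* β ≡ ℚ.½ ℚ.* ε → C ℚ.* γ ≡ ℚ.½ ℚ.* ε →
  ℚ.∣ a ∣ ℚ.< B → dist b d ℚ.< β → ℚ.∣ d ∣ ℚ.< C → dist a c ℚ.< γ →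
  dist (a ℚ.* b) (c ℚ.* d) ℚ.< ε
*-close {a} {b} {c} {d} {B} {C} {β} {γ} {ε} 0<B 0<C Bβ≡ε/2 Cγ≡ε/2 a<B bd<β d<C ac<γ =
  begin-strict
    dist (a ℚ.* b) (c ℚ.* d)
      ≤⟨ dist-* a b c d ⟩
    ℚ.∣ a ∣ ℚ.* dist b d ℚ.+ ℚ.∣ d ∣ ℚ.* dist a c
      <⟨ ℚ.+-mono-< {ℚ.∣ a ∣ ℚ.* dist b d} {B ℚ.* β} {ℚ.∣ d ∣ ℚ.* dist a c} {C ℚ.* γ}
           (≤-*-< {a} {b ℚ.- d} {B} {β} a<B 0<B bd<β)
           (≤-*-< {d} {a ℚ.- c} {C} {γ} d<C 0<C ac<γ) ⟩
    B ℚ.* β ℚ.+ C ℚ.* γ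
      ≡⟨ cong₂ ℚ._+_ Bβ≡ε/2 Cγ≡ε/2 ⟩
    ℚ.½ ℚ.* ε ℚ.+ ℚ.½ ℚ.* ε
      ≡⟨ ½*+½* ε ⟩
    ε ∎
  where open ℚ.≤-Reasoning

-- The order and equality above look only at seq, so the moduli of sums and
-- products never need to compute; unfolding them makes checking very slow.
abstract

  +-cauchy : ∀ {x y} → IsCauchy x → IsCauchy y → IsCauchy (λ n → x n ℚ.+ y n)
  +-cauchy {x} {y} cx cy ε 0<ε
    with cx (ℚ.½ ℚ.* ε) (0<½* 0<ε) | cy (ℚ.½ ℚ.* ε) (0<½* 0<ε)
  ... | M , close-x | N , close-y = M ⊔ N , λ m n M⊔N≤m M⊔N≤n →
    ℚ.≤-<-trans (dist-+ (x m) (y m) (x n) (y n))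
      (subst (dist (x m) (x n) ℚ.+ dist (y m) (y n) ℚ.<_) (½*+½* ε)
        (ℚ.+-mono-< {_} {ℚ.½ ℚ.* ε} {_} {ℚ.½ ℚ.* ε}
          (close-x m n (ℕ.m⊔n≤o⇒m≤o M N M⊔N≤m) (ℕ.m⊔n≤o⇒m≤o M N M⊔N≤n))
          (close-y m n (ℕ.m⊔n≤o⇒n≤o M N M⊔N≤m) (ℕ.m⊔n≤o⇒n≤o M N M⊔N≤n))))

  neg-cauchy : ∀ {x} → IsCauchy x → IsCauchy (λ n → ℚ.- x n)
  neg-cauchy {x} cx ε 0<ε with cx ε 0<ε
  ... | N , close = N , λ m n N≤m N≤n →
    subst (ℚ._< ε) (sym (dist-neg (x m) (x n))) (close m n N≤m N≤n)

  *-cauchy : ∀ {x y} → IsCauchy x → IsCauchy y → IsCauchy (λ n → x n ℚ.* y n)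
  *-cauchy {x} {y} cx cy ε 0<ε = combine
    (cauchy-bound cx) (cauchy-bound cy)
    where
    combine :
      (∃[ B ] 0ℚ ℚ.< B × ∃[ N ] ∀ n → N ℕ.≤ n → ℚ.∣ x n ∣ ℚ.< B) →
      (∃[ C ] 0ℚ ℚ.< C × ∃[ N ] ∀ n → N ℕ.≤ n → ℚ.∣ y n ∣ ℚ.< C) →
      ∃[ N ] ∀ m n → N ℕ.≤ m → N ℕ.≤ n → dist (x m ℚ.* y m) (x n ℚ.* y n) ℚ.< ε
    combine (B , 0<B , K , x<B) (C , 0<C , L , y<C) = choose
      (divide B (ℚ.½ ℚ.* ε) 0<B (0<½* 0<ε)) (divide C (ℚ.½ ℚ.* ε) 0<C (0<½* 0<ε))
      where
      choose : (∃[ β ] 0ℚ ℚ.< β × B ℚ.* β ≡ ℚ.½ ℚ.* ε) →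
        (∃[ γ ] 0ℚ ℚ.< γ × C ℚ.* γ ≡ ℚ.½ ℚ.* ε) →
        ∃[ N ] ∀ m n → N ℕ.≤ m → N ℕ.≤ n → dist (x m ℚ.* y m) (x n ℚ.* y n) ℚ.< ε
      choose (β , 0<β , Bβ≡ε/2) (γ , 0<γ , Cγ≡ε/2) = (K ⊔ L) ⊔ (M ⊔ N) , λ m n ≤m ≤n →
        *-close {x m} {y m} {x n} {y n} {B} {C} {β} {γ} {ε} 0<B 0<C Bβ≡ε/2 Cγ≡ε/2
          (x<B m (K≤ ≤m)) (proj₂ (cy β 0<β) m n (M≤ ≤m) (M≤ ≤n))
          (y<C n (L≤ ≤n)) (proj₂ (cx γ 0<γ) m n (N≤ ≤m) (N≤ ≤n))
        where
        M N : ℕ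
        M = proj₁ (cy β 0<β)
        N = proj₁ (cx γ 0<γ)
        K≤ : ∀ {o} → (K ⊔ L) ⊔ (M ⊔ N) ℕ.≤ o → K ℕ.≤ o
        K≤ h = ℕ.m⊔n≤o⇒m≤o K L (ℕ.m⊔n≤o⇒m≤o (K ⊔ L) (M ⊔ N) h)
        L≤ : ∀ {o} → (K ⊔ L) ⊔ (M ⊔ N) ℕ.≤ o → L ℕ.≤ o
        L≤ h = ℕ.m⊔n≤o⇒n≤o K L (ℕ.m⊔n≤o⇒m≤o (K ⊔ L) (M ⊔ N) h)
        M≤ : ∀ {o} → (K ⊔ L) ⊔ (M ⊔ N) ℕ.≤ o → M ℕ.≤ o
        M≤ h = ℕ.m⊔n≤o⇒m≤o M N (ℕ.m⊔n≤o⇒n≤o (K ⊔ L) (M ⊔ N) h)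
        N≤ : ∀ {o} → (K ⊔ L) ⊔ (M ⊔ N) ℕ.≤ o → N ℕ.≤ o
        N≤ h = ℕ.m⊔n≤o⇒n≤o M N (ℕ.m⊔n≤o⇒n≤o (K ⊔ L) (M ⊔ N) h)

infixl 6 _+_ _-_
infixl 7 _*_
infix  8 -_

_+_ : ℝ → ℝ → ℝ
x + y = mkℝ (λ n → seq x n ℚ.+ seq y n) (+-cauchy {seq x} {seq y} (cauchy x) (cauchy y))

-_ : ℝ → ℝ
- x = mkℝ (λ n → ℚ.- seq x n) (neg-cauchy {seq x} (cauchy x))

_-_ : ℝ → ℝ → ℝ
x - y = x + (- y)

_*_ : ℝ → ℝ → ℝ
x * y = mkℝ (λ n → seq x n ℚ.* seq y n) (*-cauchy {seq x} {seq y} (cauchy x) (cauchy y))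

------------------------------------------------------------------------
-- The plane

Point : Set
Point = ℝ × ℝ

infix 4 _≈ₚ_

_≈ₚ_ : Rel Point 0ℓ
(x₁ , y₁) ≈ₚ (x₂ , y₂) = x₁ ≈ x₂ × y₁ ≈ y₂

Collinear : Point → Point → Point → Set
Collinear (x₁ , y₁) (x₂ , y₂) (x₃ , y₃) =
  (x₂ - x₁) * (y₃ - y₁) ≈ (x₃ - x₁) * (y₂ - y₁)

-- p is on the closed segment from a to b.
OnSegment : Point → Point → Point → Set
OnSegment (a₁ , a₂) (b₁ , b₂) p = ∃[ t ] (0ℝ ≤ t × t ≤ 1ℝ ×
  p ≈ₚ (a₁ + t * (b₁ - a₁) , a₂ + t * (b₂ - a₂)))

------------------------------------------------------------------------
-- Finite simple graphs

record Graph : Set₁ where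
  field
    order  : ℕ
    Adj    : Rel (Fin order) 0ℓ
    adj?   : Decidable Adj
    symm   : Symmetric Adj
    irrefl : ∀ {v} → ¬ Adj v v

  Vertex : Set
  Vertex = Fin order

open Graph public using (order; Vertex)

-- The maximum of an empty family is 0.
maximum : ∀ {n} → (Fin n → ℕ) → ℕ
maximum = Vector.foldr _⊔_ 0

module _ (G : Graph) where
  open Graph G using (Adj; adj?)

  degree : Vertex G → ℕ
  degree v = length (filter (adj? v) (allFin (order G)))

  Δ : ℕ
  Δ = maximum degree

------------------------------------------------------------------------
-- Treewidth

  Connected : Set
  Connected = Vertex G × (∀ u v → Star Adj u v)

  -- A cycle of length 3 + l.
  record Cycle : Set where
    field
      l         : ℕ
      vertex    : Fin (3 ℕ.+ l) → Vertex G
      injective : Injective _≡_ _≡_ vertex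
      step      : ∀ i → Adj (vertex (inject₁ i)) (vertex (suc i))
      close     : Adj (vertex (fromℕ (2 ℕ.+ l))) (vertex zero)

  IsTree : Set
  IsTree = Connected × ¬ Cycle

record TreeDecomposition (G : Graph) : Set₁ where
  field
    tree   : Graph
    isTree : IsTree tree
    bag    : Vertex tree → Subset (order G)

  -- Adjacency in the subgraph of the tree induced by the nodes whose bags
  -- contain v.
  AdjAt : Vertex G → Rel (Vertex tree) 0ℓ
  AdjAt v s t = Graph.Adj tree s t × v ∈ bag s × v ∈ bag t

  field
    coversVertices : ∀ v → ∃[ t ] v ∈ bag t
    coversEdges    : ∀ {u v} → Graph.Adj G u v → ∃[ t ] (u ∈ bag t × v ∈ bag t)
    connectedAt    : ∀ v {s t} → v ∈ bag s → v ∈ bag t → Star (AdjAt v) s t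

  width : ℕ
  width = maximum (λ t → ∣ bag t ∣) ∸ 1

-- The minimum of a set of naturals is at most k iff some member is at most k.
infix 4 treewidth_≤_

treewidth_≤_ : Graph → ℕ → Set₁
treewidth G ≤ k = Σ (TreeDecomposition G) λ D → TreeDecomposition.width D ℕ.≤ k

------------------------------------------------------------------------
-- Rectilinear drawings

-- An unordered pair of vertices is represented by either of its orderings.
module _ {n : ℕ} where

  Pair : Set
  Pair = Fin n × Fin n

  SamePair : Rel Pair 0ℓ
  SamePair (a , b) (c , d) = (a ≡ c × b ≡ d) ⊎ (a ≡ d × b ≡ c)

  IsEnd : Fin n → Pair → Set
  IsEnd v (a , b) = v ≡ a ⊎ v ≡ b

record RectilinearDrawing (G : Graph) : Set where
  field
    pos : Vertex G → Point

  OnPair : Pair → Point → Set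
  OnPair (a , b) = OnSegment (pos a) (pos b)

  field
    distinct : Injective _≡_ _≈ₚ_ pos
    noThreeCollinear : ∀ {a b c} → a ≢ b → a ≢ c → b ≢ c →
      ¬ Collinear (pos a) (pos b) (pos c)
    noThreeConcurrent : ∀ {e f g : Pair} →
      proj₁ e ≢ proj₂ e → proj₁ f ≢ proj₂ f → proj₁ g ≢ proj₂ g →
      ¬ SamePair e f → ¬ SamePair e g → ¬ SamePair f g →
      ∀ {p} → OnPair e p → OnPair f p → OnPair g p →
      ∃[ v ] (IsEnd v e × IsEnd v f × IsEnd v g)

  IsEdge : Pair → Set
  IsEdge (a , b) = Graph.Adj G a b

  IsCrossing : Point → Set
  IsCrossing p = ∃[ e ] ∃[ f ] (IsEdge e × IsEdge f × ¬ SamePair e f ×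
    OnPair e p × OnPair f p ×
    (∀ v → IsEnd v e → IsEnd v f → ¬ (p ≈ₚ pos v)))

  -- The set of crossings has exactly m elements.
  record CrossingCount (m : ℕ) : Set where
    field
      crossing  : Fin m → Point
      sound     : ∀ i → IsCrossing (crossing i)
      injective : Injective _≡_ _≈ₚ_ crossing
      complete  : ∀ {p} → IsCrossing p → ∃[ i ] p ≈ₚ crossing i

infix 4 cr̄_≤_

cr̄_≤_ : Graph → ℕ → Set
cr̄ G ≤ b = Σ (RectilinearDrawing G) λ D →
  ∃[ m ] (RectilinearDrawing.CrossingCount D m × m ℕ.≤ b)

{-# OPTIONS --safe #-}
-- Root the tree decomposition and order the vertices by the level of their
-- highest bags.  Adding all pairs that share a bag gives a chordal graph in
-- which the earlier neighbours C(v) of v are at most k many, form a clique, and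
-- are ancestors of v in the forest that sends v to its parent p = max C(v).
--
-- Place the vertices in this order on rational points, v being extremely close
-- to p in the direction from p to q, the parent of p.  Seen from any other
-- vertices v then behaves like p, and seen from p it behaves like q.  By
-- induction a line through two vertices outside the subtree of x has the whole
-- subtree on one side.  Hence if edges vu and v′u′ with u ∈ C(v), u′ ∈ C(v′)
-- cross, then v′ lies below u and v below u′, so u and u′ are comparable, say
-- with u above u′, and u ∈ C(v) implies u ∈ C(u′).  Choosing v′, u′ ∈ C(v′),
-- u ∈ C(u′) and a neighbour v of u gives at most n k k Δ crossings.

module Submission where

open import Data.Empty using (⊥; ⊥-elim)
open import Data.Fin.Base using (Fin; zero; suc; inject₁; fromℕ; toℕ)
import Data.Fin.Properties as Fin
open import Data.Fin.Subset as Subset using (Subset)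
import Data.Fin.Subset.Properties as Subset
open import Data.List.Base
  using (List; []; _∷_; length; lookup; filter; map; deduplicate; allFin; concatMap)
import Data.List.Extrema.Nat as Extrema
open import Data.List.Membership.Propositional using (_∈_; lose)
open import Data.List.Membership.Propositional.Properties
  using (∈-filter⁺; ∈-filter⁻; ∈-map⁺; ∈-map⁻; ∈-deduplicate⁺; ∈-deduplicate⁻; ∈-lookup;
    ∈-allFin; ∈-concatMap⁺)
open import Data.List.Properties
  using (length-filter; length-map; length-deduplicate; length-++; length-tabulate)
open import Data.List.Relation.Unary.All as All using (All)
open import Data.List.Relation.Unary.AllPairs using (_∷_)
import Data.List.Relation.Unary.Any as Any
open import Data.List.Relation.Unary.Any.Properties using (lookup-index)
import Data.List.Relation.Unary.Unique.DecPropositional.Properties as Unique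
open import Data.List.Relation.Unary.Unique.Propositional using (Unique)
import Data.List.Relation.Unary.Unique.Propositional.Properties as Unique′
open import Data.Nat.Base as ℕ using (ℕ; zero; suc; z≤n; s≤s)
import Data.Nat.Properties as ℕ
open import Data.Product.Base using (∃-syntax; _×_; _,_; proj₁; proj₂)
open import Data.Product.Properties using (≡-dec)
open import Data.Rational.Base as ℚ using (ℚ; 0ℚ; 1ℚ)
import Data.Rational.Properties as ℚ
open import Data.Rational.Solver using (module +-*-Solver)
open import Data.Sum.Base using (_⊎_; inj₁; inj₂)
open import Defs
  using (divide; seq; _≈_; mk≈; eventually-close; mk≤; eventually-below; fromℚ; 0ℝ; 1ℝ;
    Point; _≈ₚ_; Collinear; OnSegment; 0<½*; ½*+½*; ≤-*-<; Graph; order; Vertex; Pair; SamePair;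
    IsEnd; RectilinearDrawing; IsTree; TreeDecomposition; maximum; degree; Δ;
    treewidth_≤_; cr̄_≤_)
open import Function.Base using (_∘_; id)
open import Function.Definitions using (Injective)
open import Level using (0ℓ)
open import Relation.Binary.Construct.Closure.ReflexiveTransitive as Closure
  using (Star; _◅_; _◅◅_)
open import Relation.Binary.Core using (Rel)
open import Relation.Binary.Definitions using (tri<; tri≈; tri>)
open import Relation.Binary.PropositionalEquality
  using (_≡_; _≢_; refl; sym; trans; cong; cong₂; subst; subst₂; module ≡-Reasoning; ≢-sym)
open import Relation.Nullary using (¬_; Dec; yes; no; ¬?)
open import Relation.Nullary.Decidable using (_×-dec_; _⊎-dec_)
open import Relation.Unary using (Decidable)

-- The term of order ε² in `near` is what makes general position possible: a point moved only
-- towards q would stay on the line pq. With the rotated direction added, the curve lies in no line,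
-- so every affine condition that is not identically violated holds for all small ε > 0. Concurrency
-- with two fixed lines is affine in the new point as well (`det-line`), so it is avoided by the
-- same argument as collinearity.
--
-- Real numbers are Cauchy sequences without a decidable order, while an exact count of crossings
-- demands decisions. Hence all vertices are rational and only an unknown crossing point remains
-- real. Incidences with it are null sequences of rationals, which become exact identities once that
-- point has been eliminated.
--
-- Two auxiliary points, with indices 0 and 1, carry no vertex. They provide a parent and a
-- grandparent, and thus a direction, even for a vertex with empty C(v).

-- Signs of rational numbers and of quadratic polynomials near 0.

module Sign where
  open import Data.Rational.Base using (_+_; _*_; _-_; -_; _<_; _≤_; ∣_∣; _⊓_)
  open +-*-Solver

  Same : ℚ → ℚ → Set
  Same x y = (0ℚ < x × 0ℚ < y) ⊎ (x < 0ℚ × y < 0ℚ)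

  Same-sym : ∀ {x y} → Same x y → Same y x
  Same-sym (inj₁ (p , q)) = inj₁ (q , p)
  Same-sym (inj₂ (p , q)) = inj₂ (q , p)

  Same-trans : ∀ {x y z} → Same x y → Same y z → Same x z
  Same-trans (inj₁ (p , _)) (inj₁ (_ , q)) = inj₁ (p , q)
  Same-trans (inj₂ (p , _)) (inj₂ (_ , q)) = inj₂ (p , q)
  Same-trans (inj₁ (_ , p)) (inj₂ (q , _)) = ⊥-elim (ℚ.<-asym p q)
  Same-trans (inj₂ (_ , p)) (inj₁ (q , _)) = ⊥-elim (ℚ.<-asym p q)

  Same-neg : ∀ {x y} → Same x y → Same (- x) (- y)
  Same-neg (inj₁ (p , q)) = inj₂ (ℚ.neg-antimono-< p , ℚ.neg-antimono-< q)
  Same-neg (inj₂ (p , q)) = inj₁ (ℚ.neg-antimono-< p , ℚ.neg-antimono-< q)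

  Same⇒≢0 : ∀ {x y} → Same x y → y ≢ 0ℚ
  Same⇒≢0 (inj₁ (_ , p)) refl = ℚ.<-irrefl refl p
  Same⇒≢0 (inj₂ (_ , p)) refl = ℚ.<-irrefl refl p

  Same-refl : ∀ {x} → x ≢ 0ℚ → Same x x
  Same-refl {x} x≢0 with ℚ.<-cmp 0ℚ x
  ... | tri< p _ _ = inj₁ (p , p)
  ... | tri≈ _ p _ = ⊥-elim (x≢0 (sym p))
  ... | tri> _ _ p = inj₂ (p , p)

  *-pos : ∀ {x y} → 0ℚ < x → 0ℚ < y → 0ℚ < x * y
  *-pos {x} {y} p q =
    ℚ.positive⁻¹ _ {{ℚ.pos*pos⇒pos x {{ℚ.positive p}} y {{ℚ.positive q}}}}

  0≤x*x : ∀ x → 0ℚ ≤ x * x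
  0≤x*x x with ℚ.<-cmp 0ℚ x
  ... | tri< p _ _ = ℚ.<⇒≤ (*-pos p p)
  ... | tri≈ _ refl _ = ℚ.≤-refl
  ... | tri> _ _ p = ℚ.<⇒≤ (subst (0ℚ <_) (solve 1 (λ x → :- x :* :- x := x :* x) refl x)
                        (*-pos (ℚ.neg-antimono-< p) (ℚ.neg-antimono-< p)))

  *-cancel-0 : ∀ {x y} → x * y ≡ 0ℚ → x ≢ 0ℚ → y ≡ 0ℚ
  *-cancel-0 {x} {y} xy≡0 x≢0 = trans (sym (ℚ.*-identityˡ y)) (trans
    (cong (_* y) (sym (ℚ.*-inverseˡ x))) (trans (ℚ.*-assoc (ℚ.1/ x) x y)
    (trans (cong (ℚ.1/ x *_) xy≡0) (ℚ.*-zeroʳ (ℚ.1/ x)))))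
    where
    instance
      nz : ℚ.NonZero x
      nz = ℚ.≢-nonZero x≢0

  -∣x∣≤x : ∀ x → - ∣ x ∣ ≤ x
  -∣x∣≤x x with ℚ.∣p∣≡p∨∣p∣≡-p x
  ... | inj₂ e = ℚ.≤-reflexive (trans (cong -_ e) (solve 1 (λ x → :- (:- x) := x) refl x))
  ... | inj₁ e = ℚ.≤-trans (ℚ.neg-antimono-≤ (ℚ.0≤∣p∣ x)) (ℚ.∣p∣≡p⇒0≤p e)

  x≤∣x∣ : ∀ x → x ≤ ∣ x ∣
  x≤∣x∣ x = subst₂ _≤_ (solve 1 (λ x → :- (:- x) := x) refl x)
    (trans (solve 1 (λ x → :- (:- x) := x) refl ∣ - x ∣) (ℚ.∣-p∣≡∣p∣ x))
    (ℚ.neg-antimono-≤ (-∣x∣≤x (- x)))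

  -- The filter of right neighbourhoods of 0. It is closed under finite intersections, so finitely
  -- many demands on a new point can be met by one ε.
  Small : (ℚ → Set) → Set
  Small P = ∃[ δ ] (0ℚ < δ × (∀ {ε} → 0ℚ < ε → ε < δ → P ε))

  Small-pure : ∀ {P : ℚ → Set} → (∀ {ε} → P ε) → Small P
  Small-pure p = 1ℚ , ℚ.positive⁻¹ 1ℚ , λ _ _ → p

  Small-map : ∀ {P Q : ℚ → Set} → (∀ {ε} → 0ℚ < ε → P ε → Q ε) → Small P → Small Q
  Small-map f (δ , 0<δ , p) = δ , 0<δ , λ 0<ε ε<δ → f 0<ε (p 0<ε ε<δ)

  Small-× : ∀ {P Q : ℚ → Set} → Small P → Small Q → Small (λ ε → P ε × Q ε)
  Small-× (δ , 0<δ , p) (δ′ , 0<δ′ , q) = δ ⊓ δ′ , min , λ 0<ε ε< →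
    p 0<ε (ℚ.<-≤-trans ε< (ℚ.p⊓q≤p δ δ′)) , q 0<ε (ℚ.<-≤-trans ε< (ℚ.p⊓q≤q δ δ′))
    where
    min : 0ℚ < δ ⊓ δ′
    min with ℚ.⊓-sel δ δ′
    ... | inj₁ e = subst (0ℚ <_) (sym e) 0<δ
    ... | inj₂ e = subst (0ℚ <_) (sym e) 0<δ′

  -- `Q` has to be decidable because a threshold must be produced before `Q` is known to hold.
  Small-→ : ∀ {Q : Set} {P : ℚ → Set} → Dec Q → (Q → Small P) → Small (λ ε → Q → P ε)
  Small-→ (yes q) p = Small-map (λ _ x _ → x) (p q)
  Small-→ (no ¬q) _ = Small-pure (λ q → ⊥-elim (¬q q))

  Small-∀< : ∀ n {P : ℕ → ℚ → Set} → (∀ i → i ℕ.< n → Small (P i)) →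
    Small (λ ε → ∀ i → i ℕ.< n → P i ε)
  Small-∀< zero p = Small-pure (λ _ ())
  Small-∀< (suc n) {P} p = Small-map
    (λ _ (pn , ps) i i<1+n → case i (ℕ.≤-pred i<1+n) pn ps)
    (Small-× (p n ℕ.≤-refl) (Small-∀< n (λ i i<n → p i (ℕ.m≤n⇒m≤1+n i<n))))
    where
    case : ∀ {ε} i → i ℕ.≤ n → P n ε → (∀ i → i ℕ.< n → P i ε) → P i ε
    case i i≤n pn ps with ℕ.m≤n⇒m<n∨m≡n i≤n
    ... | inj₁ i<n = ps i i<n
    ... | inj₂ refl = pn

  Small-witness : ∀ {P : ℚ → Set} → Small P → ∃[ ε ] (0ℚ < ε × P ε)
  Small-witness (δ , 0<δ , p) = ε , 0<ε , p 0<ε ε<δ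
    where
    ε = ℚ.½ * δ
    0<ε : 0ℚ < ε
    0<ε = *-pos {ℚ.½} {δ} (ℚ.positive⁻¹ ℚ.½) 0<δ
    ε<δ : ε < δ
    ε<δ = subst₂ _<_ (ℚ.+-identityʳ ε)
      (trans (sym (ℚ.*-distribʳ-+ δ ℚ.½ ℚ.½)) (ℚ.*-identityˡ δ))
      (ℚ.+-monoʳ-< ε 0<ε)

  -- For ε < 1 the bracket is at least -M with M = ∣b∣ + ∣c∣ + 1, so ε below both 1 and a/M
  -- suffices. The summand 1 keeps M positive when b and c vanish.
  small-pos : ∀ a b c → 0ℚ < a → Small (λ ε → 0ℚ < a + ε * (b + ε * c))
  small-pos a b c 0<a = go (divide M a 0<M 0<a)
    where
    M = (∣ b ∣ + ∣ c ∣) + 1ℚ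
    0≤bc : 0ℚ ≤ ∣ b ∣ + ∣ c ∣
    0≤bc = ℚ.+-mono-≤ {0ℚ} {∣ b ∣} {0ℚ} {∣ c ∣} (ℚ.0≤∣p∣ b) (ℚ.0≤∣p∣ c)
    0<M : 0ℚ < M
    0<M = ℚ.+-mono-≤-< {0ℚ} {∣ b ∣ + ∣ c ∣} {0ℚ} {1ℚ} 0≤bc (ℚ.positive⁻¹ 1ℚ)
    bound : ∀ {ε} → 0ℚ < ε → ε < 1ℚ → - M ≤ b + ε * c
    bound {ε} 0<ε ε<1 = begin
      - M ≡⟨ solve 3 (λ b c o → :- ((b :+ c) :+ o) := (:- b :+ :- c) :+ :- o) refl ∣ b ∣ ∣ c ∣ 1ℚ ⟩
      (- ∣ b ∣ + - ∣ c ∣) + - 1ℚ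
        ≤⟨ ℚ.+-monoʳ-≤ (- ∣ b ∣ + - ∣ c ∣) {y = 0ℚ} (ℚ.<⇒≤ (ℚ.negative⁻¹ (- 1ℚ))) ⟩
      (- ∣ b ∣ + - ∣ c ∣) + 0ℚ ≡⟨ ℚ.+-identityʳ _ ⟩
      - ∣ b ∣ + - ∣ c ∣ ≤⟨ ℚ.+-mono-≤ (-∣x∣≤x b) -c≤εc ⟩
      b + ε * c ∎
      where
      open ℚ.≤-Reasoning
      -c≤εc : - ∣ c ∣ ≤ ε * c
      -c≤εc = begin
        - ∣ c ∣ ≡⟨ cong -_ (sym (ℚ.*-identityˡ ∣ c ∣)) ⟩
        - (1ℚ * ∣ c ∣) ≤⟨ ℚ.neg-antimono-≤ (ℚ.*-monoʳ-≤-nonNeg ∣ c ∣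
             {{ℚ.∣-∣-nonNeg c}} (ℚ.<⇒≤ ε<1)) ⟩
        - (ε * ∣ c ∣) ≡⟨ solve 2 (λ e c → :- (e :* c) := e :* (:- c)) refl ε ∣ c ∣ ⟩
        ε * - ∣ c ∣ ≤⟨ ℚ.*-monoˡ-≤-nonNeg ε {{ℚ.nonNegative (ℚ.<⇒≤ 0<ε)}} (-∣x∣≤x c) ⟩
        ε * c ∎
    go : ∃[ δ ] (0ℚ < δ × M * δ ≡ a) → Small (λ ε → 0ℚ < a + ε * (b + ε * c))
    go (δ , 0<δ , Mδ≡a) = Small-map (λ { {ε} 0<ε (ε<δ , ε<1) → concl 0<ε ε<δ ε<1 })
      (Small-× {λ ε → ε < δ} {λ ε → ε < 1ℚ} (δ , 0<δ , λ _ p → p)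
        (1ℚ , ℚ.positive⁻¹ 1ℚ , λ _ p → p))
      where
      concl : ∀ {ε} → 0ℚ < ε → ε < δ → ε < 1ℚ → 0ℚ < a + ε * (b + ε * c)
      concl {ε} 0<ε ε<δ ε<1 = begin-strict
        0ℚ ≡⟨ sym (ℚ.+-inverseʳ a) ⟩
        a + - a <⟨ ℚ.+-monoʳ-< a (ℚ.neg-antimono-< εM<a) ⟩
        a + - (M * ε) ≡⟨ cong (a +_) (solve 2 (λ m e → :- (m :* e) := e :* (:- m)) refl M ε) ⟩
        a + ε * - M ≤⟨ ℚ.+-monoʳ-≤ a (ℚ.*-monoˡ-≤-nonNeg ε
           {{ℚ.nonNegative (ℚ.<⇒≤ 0<ε)}} (bound 0<ε ε<1)) ⟩
        a + ε * (b + ε * c) ∎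
        where
        open ℚ.≤-Reasoning
        εM<a : M * ε < a
        εM<a = subst (M * ε <_) Mδ≡a (ℚ.*-monoʳ-<-pos M {{ℚ.positive 0<M}} ε<δ)

  -- The lowest non-zero coefficient dominates near 0. `small-sign₁` and `small-sign₂` come back to
  -- this case by dividing out ε and padding with a zero coefficient.
  small-sign₀ : ∀ a b c → a ≢ 0ℚ → Small (λ ε → Same (a + ε * (b + ε * c)) a)
  small-sign₀ a b c a≢0 with ℚ.<-cmp 0ℚ a
  ... | tri< 0<a _ _ = Small-map (λ _ p → inj₁ (p , 0<a)) (small-pos a b c 0<a)
  ... | tri≈ _ 0≡a _ = ⊥-elim (a≢0 (sym 0≡a))
  ... | tri> _ _ a<0 = Small-map
    (λ {ε} _ p → inj₂ (subst (_< 0ℚ)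
      (solve 4 (λ a b c e → :- (:- a :+ e :* (:- b :+ e :* (:- c))) := a :+ e :* (b :+ e :* c))
        refl a b c ε)
      (ℚ.neg-antimono-< p) , a<0))
    (small-pos (- a) (- b) (- c) (ℚ.neg-antimono-< a<0))

  Same-*ˡ : ∀ {e x y} → 0ℚ < e → Same x y → Same (e * x) y
  Same-*ˡ 0<e (inj₁ (p , q)) = inj₁ (*-pos 0<e p , q)
  Same-*ˡ {e} {x} 0<e (inj₂ (p , q)) =
    inj₂ (subst (e * x <_) (ℚ.*-zeroʳ e) (ℚ.*-monoʳ-<-pos e {{ℚ.positive 0<e}} p) , q)

  small-sign₁ : ∀ a b c → a ≡ 0ℚ → b ≢ 0ℚ → Small (λ ε → Same (a + ε * (b + ε * c)) b)
  small-sign₁ _ b c refl b≢0 = Small-map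
    (λ {ε} 0<ε s → subst (λ z → Same z b)
      (solve 3 (λ b c e → e :* (b :+ e :* (c :+ e :* con 0ℚ)) := con 0ℚ :+ e :* (b :+ e :* c))
        refl b c ε)
      (Same-*ˡ 0<ε s))
    (small-sign₀ b c 0ℚ b≢0)

  small-sign₂ : ∀ a b c → a ≡ 0ℚ → b ≡ 0ℚ → c ≢ 0ℚ → Small (λ ε → Same (a + ε * (b + ε * c)) c)
  small-sign₂ _ _ c refl refl c≢0 = Small-map
    (λ {ε} 0<ε s → subst (λ z → Same z c)
      (solve 2 (λ c e → e :* (con 0ℚ :+ e :* (c :+ e :* con 0ℚ)) := con 0ℚ :+ e :* (con 0ℚ :+ e :* c))
        refl c ε)
      (Same-*ˡ 0<ε s))
    (small-sign₁ 0ℚ c 0ℚ refl c≢0)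

  small-≢0 : ∀ a b c → ¬ (a ≡ 0ℚ × b ≡ 0ℚ × c ≡ 0ℚ) → Small (λ ε → a + ε * (b + ε * c) ≢ 0ℚ)
  small-≢0 a b c h with a ℚ.≟ 0ℚ | b ℚ.≟ 0ℚ | c ℚ.≟ 0ℚ
  ... | no a≢0 | _ | _ = Small-map (λ _ s → Same⇒≢0 (Same-sym s)) (small-sign₀ a b c a≢0)
  ... | yes a≡0 | no b≢0 | _ = Small-map (λ _ s → Same⇒≢0 (Same-sym s)) (small-sign₁ a b c a≡0 b≢0)
  ... | yes a≡0 | yes b≡0 | no c≢0 =
    Small-map (λ _ s → Same⇒≢0 (Same-sym s)) (small-sign₂ a b c a≡0 b≡0 c≢0)
  ... | yes a≡0 | yes b≡0 | yes c≡0 = ⊥-elim (h (a≡0 , b≡0 , c≡0))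

-- The rational plane: orientation, concurrency and the curve of candidate points.

module Plane where
  open import Data.Rational.Base using (_+_; _*_; _-_; -_; _<_)
  open +-*-Solver
  open Sign

  Pt : Set
  Pt = ℚ × ℚ

  Line : Set
  Line = ℚ × ℚ × ℚ

  infix 8 _∙_

  -- Points have homogeneous coordinates (x , y , 1), lines are dual vectors.
  _∙_ : Line → Pt → ℚ
  (α , β , γ) ∙ (x , y) = α * x + (β * y + γ)

  line : Pt → Pt → Line
  line (x₁ , y₁) (x₂ , y₂) = y₁ - y₂ , x₂ - x₁ , x₁ * y₂ - y₁ * x₂

  -- Twice the signed area of the triangle abc; the sign tells on which side of the line ab the
  -- point c lies.
  orient : Pt → Pt → Pt → ℚ
  orient a b c = line a b ∙ c

  cross : Line → Line → Line
  cross (a , b , c) (d , e , f) = b * f - c * e , c * d - a * f , a * e - b * d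

  dot : Line → Line → ℚ
  dot (a , b , c) (d , e , f) = a * d + (b * e + c * f)

  -- The determinant with the three lines as rows, which vanishes if they are concurrent.
  det : Line → Line → Line → ℚ
  det l m n = dot (cross l m) n

  orient-swap : ∀ a b c → orient b a c ≡ - orient a b c
  orient-swap (a , a′) (b , b′) (c , c′) = solve 6 (λ a a′ b b′ c c′ →
    (b′ :- a′) :* c :+ ((a :- b) :* c′ :+ (b :* a′ :- b′ :* a)) :=
    :- ((a′ :- b′) :* c :+ ((b :- a) :* c′ :+ (a :* b′ :- a′ :* b)))) refl a a′ b b′ c c′

  orient-rotate : ∀ a b c → orient b c a ≡ orient a b c
  orient-rotate (a , a′) (b , b′) (c , c′) = solve 6 (λ a a′ b b′ c c′ →
    (b′ :- c′) :* a :+ ((c :- b) :* a′ :+ (b :* c′ :- b′ :* c)) :=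
    (a′ :- b′) :* c :+ ((b :- a) :* c′ :+ (a :* b′ :- a′ :* b))) refl a a′ b b′ c c′

  orient-aba : ∀ a b → orient a b a ≡ 0ℚ
  orient-aba (a , a′) (b , b′) = solve 4 (λ a a′ b b′ →
    (a′ :- b′) :* a :+ ((b :- a) :* a′ :+ (a :* b′ :- a′ :* b)) := con 0ℚ) refl a a′ b b′

  orient-abb : ∀ a b → orient a b b ≡ 0ℚ
  orient-abb (a , a′) (b , b′) = solve 4 (λ a a′ b b′ →
    (a′ :- b′) :* b :+ ((b :- a) :* b′ :+ (a :* b′ :- a′ :* b)) := con 0ℚ) refl a a′ b b′

  -- p + ε(q - p) + ε²J(q - p) with J the rotation by a right angle
  near : Pt → Pt → ℚ → Pt
  near (p , p′) (q , q′) ε =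
    p + ε * ((q - p) + ε * (p′ - q′)) , p′ + ε * ((q′ - p′) + ε * (q - p))

  -- The linear part of the affine function, applied to q - p and to J(q - p).
  coeff₁ coeff₂ : Line → Pt → Pt → ℚ
  coeff₁ (α , β , γ) (p , p′) (q , q′) = α * (q - p) + β * (q′ - p′)
  coeff₂ (α , β , γ) (p , p′) (q , q′) = α * (p′ - q′) + β * (q - p)

  ∙-near : ∀ l p q ε → l ∙ near p q ε ≡ l ∙ p + ε * (coeff₁ l p q + ε * coeff₂ l p q)
  ∙-near (α , β , γ) (p , p′) (q , q′) ε = solve 8 (λ α β γ p p′ q q′ ε →
    α :* (p :+ ε :* ((q :- p) :+ ε :* (p′ :- q′))) :+
      (β :* (p′ :+ ε :* ((q′ :- p′) :+ ε :* (q :- p))) :+ γ) :=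
    (α :* p :+ (β :* p′ :+ γ)) :+
      ε :* ((α :* (q :- p) :+ β :* (q′ :- p′)) :+ ε :* (α :* (p′ :- q′) :+ β :* (q :- p))))
    refl α β γ p p′ q q′ ε

  -- This is why the new point, seen from p itself, looks like q: on a line through p the constant
  -- term is gone and the value at q takes over.
  ∙-coeff₁ : ∀ l p q → l ∙ p ≡ 0ℚ → coeff₁ l p q ≡ l ∙ q
  ∙-coeff₁ l@(α , β , γ) p@(p₁ , p₂) q@(q₁ , q₂) lp≡0 = trans
    (solve 7 (λ α β γ p p′ q q′ →
      α :* (q :- p) :+ β :* (q′ :- p′) :=
      (α :* q :+ (β :* q′ :+ γ)) :- (α :* p :+ (β :* p′ :+ γ))) refl α β γ p₁ p₂ q₁ q₂)
    (trans (cong (λ z → l ∙ q - z) lp≡0) (ℚ.+-identityʳ (l ∙ q)))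

  norm² : Pt → Pt → ℚ
  norm² (p , p′) (q , q′) = (q - p) * (q - p) + (q′ - p′) * (q′ - p′)

  p-q≡0⇒p≡q : ∀ {p q} → p - q ≡ 0ℚ → p ≡ q
  p-q≡0⇒p≡q {p} {q} e = trans (solve 2 (λ p q → p := (p :- q) :+ q) refl p q)
    (trans (cong (_+ q) e) (ℚ.+-identityˡ q))

  square-sum-pos : ∀ {x y} → x ≢ 0ℚ → 0ℚ < x * x + y * y
  square-sum-pos {x} {y} x≢0 = ℚ.+-mono-<-≤ {0ℚ} {x * x} {0ℚ} {y * y} 0<xx (0≤x*x y)
    where
    0<xx : 0ℚ < x * x
    0<xx with ℚ.<-cmp 0ℚ (x * x)
    ... | tri< p _ _ = p
    ... | tri≈ _ e _ = ⊥-elim (x≢0 (*-cancel-0 (sym e) x≢0))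
    ... | tri> _ _ p = ⊥-elim (ℚ.<-irrefl refl (ℚ.<-≤-trans p (0≤x*x x)))

  norm²≢0 : ∀ {p q} → p ≢ q → norm² p q ≢ 0ℚ
  norm²≢0 {p , p′} {q , q′} p≢q e with q - p ℚ.≟ 0ℚ | q′ - p′ ℚ.≟ 0ℚ
  ... | no x≢0 | _ = ℚ.<-irrefl (sym e) (square-sum-pos {q - p} {q′ - p′} x≢0)
  ... | yes _ | no y≢0 = ℚ.<-irrefl (sym (trans (ℚ.+-comm (sq (q′ - p′)) (sq (q - p))) e))
                           (square-sum-pos {q′ - p′} {q - p} y≢0)
    where
    sq : ℚ → ℚ
    sq x = x * x
  ... | yes x≡0 | yes y≡0 = p≢q (sym (cong₂ _,_ (p-q≡0⇒p≡q x≡0) (p-q≡0⇒p≡q y≡0)))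

  -- If an affine function and both coefficients of its expansion along the
  -- curve vanish, then so does its linear part, since q - p and J(q - p) are
  -- orthogonal.
  vanishing : ∀ l {p q} → p ≢ q →
    l ∙ p ≡ 0ℚ → coeff₁ l p q ≡ 0ℚ → coeff₂ l p q ≡ 0ℚ → ∀ w → l ∙ w ≡ 0ℚ
  vanishing (α , β , γ) {p , p′} {q , q′} p≢q e₀ e₁ e₂ (w , w′) = begin
    α * w + (β * w′ + γ)
      ≡⟨ solve 7 (λ α β γ p p′ w w′ → α :* w :+ (β :* w′ :+ γ) :=
           (α :* p :+ (β :* p′ :+ γ)) :+ (α :* (w :- p) :+ β :* (w′ :- p′)))
           refl α β γ p p′ w w′ ⟩
    (α * p + (β * p′ + γ)) + (α * (w - p) + β * (w′ - p′))
      ≡⟨ cong₂ _+_ e₀ (cong₂ (λ α β → α * (w - p) + β * (w′ - p′)) α≡0 β≡0) ⟩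
    0ℚ + (0ℚ * (w - p) + 0ℚ * (w′ - p′))
      ≡⟨ solve 2 (λ x y → con 0ℚ :+ (con 0ℚ :* x :+ con 0ℚ :* y) := con 0ℚ) refl (w - p) (w′ - p′) ⟩
    0ℚ ∎
    where
    open ≡-Reasoning
    d d′ : ℚ
    d = q - p
    d′ = q′ - p′
    comb : ∀ x y → x * (α * d + β * d′) + y * (α * (p′ - q′) + β * d) ≡ 0ℚ
    comb x y = trans (cong₂ (λ u v → x * u + y * v) e₁ e₂)
      (solve 2 (λ x y → x :* con 0ℚ :+ y :* con 0ℚ := con 0ℚ) refl x y)
    -- Cramer's rule for the equations `e₁` and `e₂` in α and β, whose determinant is the squared
    -- distance of p and q.
    α≡0 : α ≡ 0ℚ
    α≡0 = *-cancel-0 {norm² (p , p′) (q , q′)} (trans (solve 6 (λ α β p p′ q q′ →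
      ((q :- p) :* (q :- p) :+ (q′ :- p′) :* (q′ :- p′)) :* α :=
      (q :- p) :* (α :* (q :- p) :+ β :* (q′ :- p′)) :+
      (:- (q′ :- p′)) :* (α :* (p′ :- q′) :+ β :* (q :- p))) refl α β p p′ q q′) (comb d (- d′)))
      (norm²≢0 p≢q)
    β≡0 : β ≡ 0ℚ
    β≡0 = *-cancel-0 {norm² (p , p′) (q , q′)} (trans (solve 6 (λ α β p p′ q q′ →
      ((q :- p) :* (q :- p) :+ (q′ :- p′) :* (q′ :- p′)) :* β :=
      (q′ :- p′) :* (α :* (q :- p) :+ β :* (q′ :- p′)) :+
      (q :- p) :* (α :* (p′ :- q′) :+ β :* (q :- p))) refl α β p p′ q q′) (comb d′ d))
      (norm²≢0 p≢q)

  -- The point `w` witnesses that the affine function is not identically zero. By `vanishing` its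
  -- restriction to the curve is then a non-zero polynomial in ε, which has no small positive roots.
  near-≢0 : ∀ l {p q w} → p ≢ q → l ∙ w ≢ 0ℚ → Small (λ ε → l ∙ near p q ε ≢ 0ℚ)
  near-≢0 l {p} {q} {w} p≢q lw≢0 = Small-map
    (λ {ε} _ h e → h (trans (sym (∙-near l p q ε)) e))
    (small-≢0 (l ∙ p) (coeff₁ l p q) (coeff₂ l p q)
      (λ (e₀ , e₁ , e₂) → lw≢0 (vanishing l p≢q e₀ e₁ e₂ w)))

  near-sign₀ : ∀ l {p q} → l ∙ p ≢ 0ℚ → Small (λ ε → Same (l ∙ near p q ε) (l ∙ p))
  near-sign₀ l {p} {q} lp≢0 = Small-map
    (λ {ε} _ → subst (λ z → Same z (l ∙ p)) (sym (∙-near l p q ε)))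
    (small-sign₀ (l ∙ p) (coeff₁ l p q) (coeff₂ l p q) lp≢0)

  near-sign₁ : ∀ l {p q} → l ∙ p ≡ 0ℚ → l ∙ q ≢ 0ℚ → Small (λ ε → Same (l ∙ near p q ε) (l ∙ q))
  near-sign₁ l {p} {q} lp≡0 lq≢0 = Small-map
    (λ {ε} _ → subst₂ Same (sym (∙-near l p q ε)) (∙-coeff₁ l p q lp≡0))
    (small-sign₁ (l ∙ p) (coeff₁ l p q) (coeff₂ l p q) lp≡0
      (λ e → lq≢0 (trans (sym (∙-coeff₁ l p q lp≡0)) e)))

  -- The line through a and the point with homogeneous coordinates h
  pencil : Pt → Line → Line
  pencil (a , a′) (h₁ , h₂ , h₃) = a′ * h₃ - h₂ , h₁ - a * h₃ , a * h₂ - a′ * h₁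

  -- With `a` and the other two lines fixed, concurrency is a linear equation for `x`: the line
  -- joining `a` to the intersection of the other two must contain `x`. So `near-≢0` applies.
  det-line : ∀ l m x a → det l m (line x a) ≡ pencil a (cross l m) ∙ x
  det-line l m (x , x′) (a , a′) = triple (cross l m)
    where
    triple : ∀ h → dot h (line (x , x′) (a , a′)) ≡ pencil (a , a′) h ∙ (x , x′)
    triple (h₁ , h₂ , h₃) = solve 7 (λ h₁ h₂ h₃ x x′ a a′ →
      h₁ :* (x′ :- a′) :+ (h₂ :* (a :- x) :+ h₃ :* (x :* a′ :- x′ :* a)) :=
      (a′ :* h₃ :- h₂) :* x :+ ((h₁ :- a :* h₃) :* x′ :+ (a :* h₂ :- a′ :* h₁)))
      refl h₁ h₂ h₃ x x′ a a′

  -- Binet–Cauchy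
  pencil-cross : ∀ l m a c → pencil a (cross l m) ∙ c ≡ (l ∙ c) * (m ∙ a) - (l ∙ a) * (m ∙ c)
  pencil-cross (l₁ , l₂ , l₃) (m₁ , m₂ , m₃) (a , a′) (c , c′) =
    solve 10 (λ l₁ l₂ l₃ m₁ m₂ m₃ a a′ c c′ →
      (a′ :* (l₁ :* m₂ :- l₂ :* m₁) :- (l₃ :* m₁ :- l₁ :* m₃)) :* c :+
        (((l₂ :* m₃ :- l₃ :* m₂) :- a :* (l₁ :* m₂ :- l₂ :* m₁)) :* c′ :+
         (a :* (l₃ :* m₁ :- l₁ :* m₃) :- a′ :* (l₂ :* m₃ :- l₃ :* m₂))) :=
      (l₁ :* c :+ (l₂ :* c′ :+ l₃)) :* (m₁ :* a :+ (m₂ :* a′ :+ m₃)) :-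
      (l₁ :* a :+ (l₂ :* a′ :+ l₃)) :* (m₁ :* c :+ (m₂ :* c′ :+ m₃)))
      refl l₁ l₂ l₃ m₁ m₂ m₃ a a′ c c′

  *-≢0 : ∀ {x y} → x ≢ 0ℚ → y ≢ 0ℚ → x * y ≢ 0ℚ
  *-≢0 x≢0 y≢0 e = y≢0 (*-cancel-0 e x≢0)

  neg-≢0 : ∀ {x} → x ≢ 0ℚ → - x ≢ 0ℚ
  neg-≢0 {x} x≢0 e = x≢0 (trans (solve 1 (λ x → x := :- (:- x)) refl x) (cong -_ e))

  -- Evaluated at c, one of the two products in `pencil-cross` vanishes because c lies on the line
  -- cd, and the other is non-zero by assumption. Thus c is the witness that `near-≢0` asks for.
  pencil-≢0 : ∀ {c d e f a} → orient c d a ≢ 0ℚ → orient e f c ≢ 0ℚ →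
    pencil a (cross (line c d) (line e f)) ∙ c ≢ 0ℚ
  pencil-≢0 {c} {d} {e} {f} {a} cda efc h = neg-≢0 (*-≢0 cda efc) (begin
    - (orient c d a * orient e f c)
      ≡⟨ solve 2 (λ x y → :- x := con 0ℚ :* y :- x) refl
           (orient c d a * orient e f c) (orient e f a) ⟩
    0ℚ * orient e f a - orient c d a * orient e f c
      ≡⟨ cong (λ z → z * orient e f a - orient c d a * orient e f c) (sym (orient-aba c d)) ⟩
    orient c d c * orient e f a - orient c d a * orient e f c
      ≡⟨ sym (pencil-cross (line c d) (line e f) a c) ⟩
    pencil a (cross (line c d) (line e f)) ∙ c
      ≡⟨ h ⟩
    0ℚ ∎)
    where open ≡-Reasoning

-- Placing points along a forest, and the sides of lines on which subtrees lie.

Apart : {A : Set} → A → A → A → A → Set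
Apart a b c d = a ≢ c × a ≢ d × b ≢ c × b ≢ d

module Placement (par : ℕ → ℕ)
  (par-< : ∀ i → par (suc i) ℕ.< suc i)
  (par-pos : ∀ i → 1 ℕ.≤ par (2 ℕ.+ i)) where
  open import Data.Nat.Base using (_<_; _≤_; _+_)
  open Sign
  open Plane

  grand : ℕ → ℕ
  grand v = par (par v)

  par<′ : ∀ {v} → 1 ≤ v → par v < v
  par<′ (s≤s {n = i} _) = par-< i

  1≤par : ∀ {v} → 2 ≤ v → 1 ≤ par v
  1≤par (s≤s (s≤s {n = i} _)) = par-pos i

  par-<-2 : ∀ {v} → 2 ≤ v → par v < v
  par-<-2 h = par<′ (ℕ.≤-trans (ℕ.n≤1+n 1) h)

  grand<par : ∀ {v} → 2 ≤ v → grand v < par v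
  grand<par h = par<′ (1≤par h)

  grand< : ∀ {v} → 2 ≤ v → grand v < v
  grand< h = ℕ.<-trans (grand<par h) (par-<-2 h)

  -- The inequalities that put c, d, a and likewise c, e, f in general position, as `pencil-≢0`
  -- requires.
  record Distinct₅ (a c d e f : ℕ) : Set where
    constructor distinct₅
    field
      c≢d : c ≢ d
      c≢a : c ≢ a
      d≢a : d ≢ a
      c≢e : c ≢ e
      c≢f : c ≢ f
      e≢f : e ≢ f

  distinct₅? : ∀ a c d e f → Dec (Distinct₅ a c d e f)
  distinct₅? a c d e f
    with ¬? (c ℕ.≟ d) ×-dec ¬? (c ℕ.≟ a) ×-dec ¬? (d ℕ.≟ a) ×-dec
         ¬? (c ℕ.≟ e) ×-dec ¬? (c ℕ.≟ f) ×-dec ¬? (e ℕ.≟ f)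
  ... | yes (p , q , r , s , t , u) = yes (distinct₅ p q r s t u)
  ... | no h = no λ (distinct₅ p q r s t u) → h (p , q , r , s , t , u)

  -- All conditions refer to earlier indices only, so later points never disturb them. A symmetric
  -- statement about several indices is recovered by applying them at the largest one.
  record Placed (f : ℕ → Pt) (v : ℕ) (x : Pt) : Set where
    field
      general : ∀ a → a < v → ∀ b → b < v → a ≢ b → orient (f a) (f b) x ≢ 0ℚ
      nonconcurrent : ∀ a → a < v → ∀ c → c < v → ∀ d → d < v → ∀ e → e < v → ∀ g → g < v →
        Distinct₅ a c d e g →
        det (line (f c) (f d)) (line (f e) (f g)) (line x (f a)) ≢ 0ℚ
      like-parent : 2 ≤ v → ∀ a → a < v → ∀ b → b < v →
        a ≢ b × a ≢ par v × b ≢ par v →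
        Same (orient (f a) (f b) x) (orient (f a) (f b) (f (par v)))
      towards-grand : 2 ≤ v → ∀ b → b < v → b ≢ par v × b ≢ grand v →
        Same (orient (f (par v)) (f b) x) (orient (f (par v)) (f b) (f (grand v)))

  Placed-resp : ∀ {f g v x} → (∀ i → i < v → f i ≡ g i) → Placed f v x → Placed g v x
  Placed-resp {f} {g} {v} {x} f≡g P = record
    { general = λ a a< b b< h →
        subst₂ (λ y z → orient y z x ≢ 0ℚ) (f≡g a a<) (f≡g b b<) (P.general a a< b b< h)
    ; nonconcurrent = λ a a< c c< d d< e e< h h< D →
        subst₂ (λ y z → det (line y z) (line (g e) (g h)) (line x (g a)) ≢ 0ℚ)
          (f≡g c c<) (f≡g d d<)
        (subst₂ (λ y z → det (line (f c) (f d)) (line y z) (line x (g a)) ≢ 0ℚ)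
          (f≡g e e<) (f≡g h h<)
        (subst (λ y → det (line (f c) (f d)) (line (f e) (f h)) (line x y) ≢ 0ℚ)
          (f≡g a a<)
          (P.nonconcurrent a a< c c< d d< e e< h h< D)))
    ; like-parent = λ 2≤v a a< b b< h →
        subst (λ p → Same (orient (g a) (g b) x) (orient (g a) (g b) p)) (f≡g _ (par-<-2 2≤v))
        (subst₂ (λ y z → Same (orient y z x) (orient y z (f (par v)))) (f≡g a a<) (f≡g b b<)
          (P.like-parent 2≤v a a< b b< h))
    ; towards-grand = λ 2≤v b b< h →
        subst (λ q → Same (orient (g (par v)) (g b) x) (orient (g (par v)) (g b) q))
          (f≡g _ (grand< 2≤v))
        (subst₂ (λ y z → Same (orient y z x) (orient y z (f (grand v)))) (f≡g _ (par-<-2 2≤v))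
          (f≡g b b<) (P.towards-grand 2≤v b b< h))
    }
    where module P = Placed P

  AllPlaced : (ℕ → Pt) → ℕ → Set
  AllPlaced f n = ∀ v → v < n → Placed f v (f v)

  -- The largest of the three indices was placed off the line of the other two; a cyclic rotation of
  -- the determinant brings it into last position.
  general-position : ∀ {f n} → AllPlaced f n → ∀ {a b c} → a < n → b < n → c < n →
    a ≢ b → a ≢ c → b ≢ c → orient (f a) (f b) (f c) ≢ 0ℚ
  general-position {f} P {a} {b} {c} a<n b<n c<n a≢b a≢c b≢c
    with ℕ.<-cmp a b | ℕ.<-cmp b c | ℕ.<-cmp a c
  ... | tri≈ _ e _ | _ | _ = ⊥-elim (a≢b e)
  ... | _ | tri≈ _ e _ | _ = ⊥-elim (b≢c e)
  ... | _ | _ | tri≈ _ e _ = ⊥-elim (a≢c e)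
  ... | _ | tri< b<c _ _ | tri< a<c _ _ = Placed.general (P c c<n) a a<c b b<c a≢b
  ... | tri< a<b _ _ | tri> _ _ c<b | _ = λ h →
    Placed.general (P b b<n) c c<b a a<b (≢-sym a≢c)
      (trans (sym (orient-rotate (f c) (f a) (f b))) h)
  ... | tri> _ _ b<a | _ | tri> _ _ c<a = λ h →
    Placed.general (P a a<n) b b<a c c<a b≢c (trans (orient-rotate (f a) (f b) (f c)) h)
  ... | tri< a<b _ _ | tri< b<c _ _ | tri> _ _ c<a = ⊥-elim (ℕ.<-asym (ℕ.<-trans a<b b<c) c<a)
  ... | tri> _ _ b<a | tri> _ _ c<b | tri< a<c _ _ = ⊥-elim (ℕ.<-asym (ℕ.<-trans c<b b<a) a<c)

  module Step {f n} (P : AllPlaced f n) (2≤n : 2 ≤ n) (f-inj : f (grand n) ≢ f (par n)) where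
    p<n : par n < n
    p<n = par-<-2 2≤n
    q<n : grand n < n
    q<n = grand< 2≤n
    p≢q : f (par n) ≢ f (grand n)
    p≢q e = f-inj (sym e)

    l : ℕ → ℕ → Line
    l a b = line (f a) (f b)

    -- The point p + J(q - p), at which the determinant is the squared distance of p and q. It
    -- replaces a third placed point, which does not exist yet when n = 2.
    apex : ∃[ w ] (orient (f (par n)) (f (grand n)) w ≢ 0ℚ)
    apex = go (f (par n)) (f (grand n)) p≢q
      where
      go : ∀ p q → p ≢ q → ∃[ w ] (orient p q w ≢ 0ℚ)
      go (p , p′) (q , q′) p≢q = (p ℚ.+ (p′ ℚ.- q′) , p′ ℚ.+ (q ℚ.- p)) ,
        λ h → norm²≢0 p≢q (trans (solve 4 (λ p p′ q q′ →
          (q :- p) :* (q :- p) :+ (q′ :- p′) :* (q′ :- p′) :=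
          (p′ :- q′) :* (p :+ (p′ :- q′)) :+
            ((q :- p) :* (p′ :+ (q :- p)) :+ (p :* q′ :- p′ :* q))) refl p p′ q q′) h)
        where open +-*-Solver

    -- The witness for `near-≢0`: the parent or the grandparent of `n`, whichever is off the line
    -- ab, and `apex` when ab is the line through both.
    off-line : ∀ a → a < n → ∀ b → b < n → a ≢ b → ∃[ w ] (orient (f a) (f b) w ≢ 0ℚ)
    off-line a a< b b< a≢b with a ℕ.≟ par n | b ℕ.≟ par n | a ℕ.≟ grand n | b ℕ.≟ grand n
    ... | no a≢p | no b≢p | _ | _ = f (par n) , general-position P a< b< p<n a≢b a≢p b≢p
    ... | yes refl | _ | _ | no b≢q =
      f (grand n) , general-position P a< b< q<n a≢b (λ e → p≢q (cong f e)) b≢q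
    ... | _ | yes refl | no a≢q | _ =
      f (grand n) , general-position P a< b< q<n a≢b a≢q (λ e → p≢q (cong f e))
    ... | yes a≡p | _ | _ | yes b≡q = proj₁ apex , λ h → proj₂ apex
      (subst₂ (λ a b → orient (f a) (f b) (proj₁ apex) ≡ 0ℚ) a≡p b≡q h)
    ... | _ | yes b≡p | yes a≡q | _ = proj₁ apex , λ h → neg-≢0 (proj₂ apex)
      (trans (sym (orient-swap (f (par n)) (f (grand n)) (proj₁ apex)))
        (subst₂ (λ a b → orient (f a) (f b) (proj₁ apex) ≡ 0ℚ) a≡q b≡p h))

    x : ℚ → Pt
    x = near (f (par n)) (f (grand n))

    General Nonconcurrent LikeParent TowardsGrand : ℚ → Set
    General ε = ∀ a → a < n → ∀ b → b < n → a ≢ b → orient (f a) (f b) (x ε) ≢ 0ℚ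
    Nonconcurrent ε =
      ∀ a → a < n → ∀ c → c < n → ∀ d → d < n → ∀ e → e < n → ∀ g → g < n →
        Distinct₅ a c d e g → det (l c d) (l e g) (line (x ε) (f a)) ≢ 0ℚ
    LikeParent ε = ∀ a → a < n → ∀ b → b < n → a ≢ b × a ≢ par n × b ≢ par n →
      Same (orient (f a) (f b) (x ε)) (orient (f a) (f b) (f (par n)))
    TowardsGrand ε = ∀ b → b < n → b ≢ par n × b ≢ grand n →
      Same (orient (f (par n)) (f b) (x ε)) (orient (f (par n)) (f b) (f (grand n)))

    general : Small General
    general = Small-∀< n λ a a< → Small-∀< n λ b b< → Small-→ (¬? (a ℕ.≟ b)) λ a≢b →
      near-≢0 (l a b) p≢q (proj₂ (off-line a a< b b< a≢b))

    nonconcurrent : Small Nonconcurrent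
    nonconcurrent = Small-∀< n λ a a< → Small-∀< n λ c c< → Small-∀< n λ d d< →
      Small-∀< n λ e e< → Small-∀< n λ g g< → Small-→ (distinct₅? a c d e g)
      λ (distinct₅ c≢d c≢a d≢a c≢e c≢g e≢g) → Small-map
        (λ {ε} _ → subst (_≢ 0ℚ) (sym (det-line (l c d) (l e g) (x ε) (f a))))
        (near-≢0 (pencil (f a) (cross (l c d) (l e g))) {w = f c} p≢q
          (pencil-≢0 {f c} {f d} {f e} {f g} {f a}
            (general-position P c< d< a< c≢d c≢a d≢a)
            (general-position P e< g< c< e≢g (≢-sym c≢e) (≢-sym c≢g))))

    like-parent : Small LikeParent
    like-parent = Small-∀< n λ a a< → Small-∀< n λ b b< →
      Small-→ (¬? (a ℕ.≟ b) ×-dec ¬? (a ℕ.≟ par n) ×-dec ¬? (b ℕ.≟ par n)) λ (a≢b , a≢p , b≢p) →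
        near-sign₀ (l a b) {f (par n)} {f (grand n)} (general-position P a< b< p<n a≢b a≢p b≢p)

    towards-grand : Small TowardsGrand
    towards-grand = Small-∀< n λ b b< →
      Small-→ (¬? (b ℕ.≟ par n) ×-dec ¬? (b ℕ.≟ grand n)) λ (b≢p , b≢q) →
        near-sign₁ (l (par n) b) {f (par n)} {f (grand n)} (orient-aba (f (par n)) (f b))
          (general-position P p<n b< q<n (≢-sym b≢p) (λ e → p≢q (cong f e)) b≢q)

    placed : ∀ ε → (General ε × Nonconcurrent ε) × (LikeParent ε × TowardsGrand ε) →
      Placed f n (x ε)
    placed ε ((g , nc) , (lp , tg)) = record
      { general = g ; nonconcurrent = nc ; like-parent = λ _ → lp ; towards-grand = λ _ → tg }

    abstract
      place : ∃[ y ] Placed f n y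
      place = let (ε , _ , h) = Small-witness {λ ε → (General ε × Nonconcurrent ε) ×
                    (LikeParent ε × TowardsGrand ε)} (Small-× (Small-× general nonconcurrent)
                    (Small-× like-parent towards-grand))
              in x ε , placed ε h

  record Stage (n : ℕ) : Set where
    field
      at        : ℕ → Pt
      placed    : AllPlaced at n
      injective : ∀ {a b} → a < n → b < n → a ≢ b → at a ≢ at b

  override : (ℕ → Pt) → ℕ → Pt → ℕ → Pt
  override f n x i with i ℕ.≟ n
  ... | yes _ = x
  ... | no _ = f i

  override-≡ : ∀ f n x → override f n x n ≡ x
  override-≡ f n x with n ℕ.≟ n
  ... | yes _ = refl
  ... | no h = ⊥-elim (h refl)

  override-< : ∀ f {n} x {i} → i < n → f i ≡ override f n x i
  override-< f {n} x {i} i<n with i ℕ.≟ n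
  ... | yes refl = ⊥-elim (ℕ.<-irrefl refl i<n)
  ... | no _ = refl

  another : ∀ {n} → 2 ≤ n → ∀ a → ∃[ b ] (b < n × a ≢ b)
  another 2≤n zero = 1 , 2≤n , λ ()
  another 2≤n (suc a) = 0 , ℕ.≤-trans (s≤s z≤n) 2≤n , λ ()

  extend-by : ∀ {n} → 2 ≤ n → (S : Stage n) → ∀ x → Placed (Stage.at S) n x → Stage (suc n)
  extend-by {n} 2≤n S x Px = record { at = at′ ; placed = placed′ ; injective = injective′ }
    where
    open Stage S
    at′ : ℕ → Pt
    at′ = override at n x
    old : ∀ {i} → i < n → at i ≡ at′ i
    old = override-< at {n} x
    at′-n : at′ n ≡ x
    at′-n = override-≡ at n x
    placed′ : AllPlaced at′ (suc n)
    placed′ v v<1+n with ℕ.m≤n⇒m<n∨m≡n (ℕ.≤-pred v<1+n)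
    ... | inj₁ v<n = Placed-resp {at} {at′} {v} {at′ v} (λ i i<v → old (ℕ.<-trans i<v v<n))
      (subst (Placed at v) (old v<n) (placed v v<n))
    ... | inj₂ refl = Placed-resp {at} {at′} {v} {at′ v} (λ i i<v → old i<v)
      (subst (Placed at v) (sym at′-n) Px)
    -- If x were an earlier point, it would be collinear with that point and any second one.
    new : ∀ {a} → a < n → at a ≢ x
    new {a} a<n e with another 2≤n a
    ... | b , b<n , a≢b = Placed.general (Px) a a<n b b<n a≢b
      (subst (λ z → orient (at a) (at b) z ≡ 0ℚ) e (orient-aba (at a) (at b)))
    injective′ : ∀ {a b} → a < suc n → b < suc n → a ≢ b → at′ a ≢ at′ b
    injective′ {a} {b} a< b< a≢b
      with ℕ.m≤n⇒m<n∨m≡n (ℕ.≤-pred a<) | ℕ.m≤n⇒m<n∨m≡n (ℕ.≤-pred b<)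
    ... | inj₁ a<n | inj₁ b<n =
      subst₂ _≢_ (old a<n) (old b<n) (injective a<n b<n a≢b)
    ... | inj₁ a<n | inj₂ refl =
      subst₂ _≢_ (old a<n) (sym (at′-n)) (new a<n)
    ... | inj₂ refl | inj₁ b<n =
      subst₂ _≢_ (sym (at′-n)) (old b<n) (≢-sym (new b<n))
    ... | inj₂ refl | inj₂ refl = ⊥-elim (a≢b refl)

  extend : ∀ {n} → 2 ≤ n → Stage n → Stage (suc n)
  extend {n} 2≤n S = extend-by 2≤n S (proj₁ new) (proj₂ new)
    where
    new : ∃[ y ] Placed (Stage.at S) n y
    new = Step.place (Stage.placed S) 2≤n
      (Stage.injective S (grand< 2≤n) (par-<-2 2≤n) (ℕ.<⇒≢ (grand<par 2≤n)))

  two-points : ℕ → Pt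
  two-points zero = 0ℚ , 0ℚ
  two-points (suc _) = 1ℚ , 0ℚ

  -- Below an index v < 2 there is at most one index, so no two distinct ones have to be considered.
  initial : Stage 2
  initial = record
    { at = two-points
    ; placed = λ v v<2 → record
      { general = λ a a< b b< a≢b → ⊥-elim (a≢b (collapse v<2 a< b<))
      ; nonconcurrent = λ a a< c c< d d< e e< g g< D →
          ⊥-elim (Distinct₅.c≢d D (collapse v<2 c< d<))
      ; like-parent = λ 2≤v → ⊥-elim (ℕ.<⇒≱ v<2 2≤v)
      ; towards-grand = λ 2≤v → ⊥-elim (ℕ.<⇒≱ v<2 2≤v) }
    ; injective = inj }
    where
    collapse : ∀ {v a b} → v < 2 → a < v → b < v → a ≡ b
    collapse (s≤s (s≤s z≤n)) (s≤s z≤n) (s≤s z≤n) = refl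
    inj : ∀ {a b} → a < 2 → b < 2 → a ≢ b → two-points a ≢ two-points b
    inj {zero} {zero} _ _ a≢b _ = a≢b refl
    inj {zero} {suc b} _ _ _ ()
    inj {suc a} {zero} _ _ _ ()
    inj {suc zero} {suc zero} _ _ a≢b _ = a≢b refl
    inj {suc zero} {suc (suc b)} _ (s≤s (s≤s ())) _ _
    inj {suc (suc a)} (s≤s (s≤s ())) _ _ _

  stage : ∀ n → Stage (2 + n)
  stage zero = initial
  stage (suc n) = extend (s≤s (s≤s z≤n)) (stage n)

  stage-suc : ∀ n {i} → i < 2 + n → Stage.at (stage n) i ≡ Stage.at (stage (suc n)) i
  stage-suc n i< = override-< (Stage.at (stage n)) _ i<

  abstract
    -- The diagonal of the stages: each stage changes only the value at its new index, so the point
    -- of index i is final from stage i on.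
    position : ℕ → Pt
    position i = Stage.at (stage i) i

    position-stage : ∀ {i n} → i < 2 + n → position i ≡ Stage.at (stage n) i
    position-stage {i} {n} i<2+n with ℕ.≤-total i n
    ... | inj₁ i≤n = up i≤n
      where
      up : ∀ {m} → i ≤ m → position i ≡ Stage.at (stage m) i
      up {m} i≤m with ℕ.m≤n⇒m<n∨m≡n i≤m
      up {suc m} _ | inj₁ (s≤s i≤m) = trans (up i≤m) (stage-suc m (s≤s (ℕ.m≤n⇒m≤1+n i≤m)))
      up _ | inj₂ refl = refl
    ... | inj₂ n≤i = down n≤i
      where
      down : ∀ {m} → n ≤ m → Stage.at (stage m) i ≡ Stage.at (stage n) i
      down {m} n≤m with ℕ.m≤n⇒m<n∨m≡n n≤m
      down {suc m} _ | inj₁ (s≤s n≤m) = trans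
        (sym (stage-suc m (ℕ.<-≤-trans i<2+n (s≤s (s≤s n≤m))))) (down n≤m)
      down _ | inj₂ refl = refl

    position-placed : ∀ v → Placed position v (position v)
    position-placed v = Placed-resp
      (λ i i<v → sym (position-stage (ℕ.<-trans i<v (s≤s (ℕ.n≤1+n v)))))
      (Stage.placed (stage v) v (s≤s (ℕ.n≤1+n v)))

  position-general : ∀ {a b c} → a ≢ b → a ≢ c → b ≢ c →
    orient (position a) (position b) (position c) ≢ 0ℚ
  position-general {a} {b} {c} = general-position {n = suc (a + (b + c))}
    (λ v _ → position-placed v) (s≤s (ℕ.m≤m+n a (b + c)))
    (s≤s (ℕ.≤-trans (ℕ.m≤m+n b c) (ℕ.m≤n+m (b + c) a)))
    (s≤s (ℕ.≤-trans (ℕ.m≤n+m c b) (ℕ.m≤n+m (b + c) a)))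

  infix 4 _≼_

  -- Ancestors in the forest. The bound `2 ≤ y` makes the auxiliary indices 0 and 1 roots.
  data _≼_ (x : ℕ) : ℕ → Set where
    here : x ≼ x
    up   : ∀ {y} → 2 ≤ y → x ≼ par y → x ≼ y

  ≼⇒≤ : ∀ {x y} → x ≼ y → x ≤ y
  ≼⇒≤ here = ℕ.≤-refl
  ≼⇒≤ (up 2≤y h) = ℕ.≤-trans (≼⇒≤ h) (ℕ.<⇒≤ (par-<-2 2≤y))

  ≼-trans : ∀ {x y z} → x ≼ y → y ≼ z → x ≼ z
  ≼-trans h here = h
  ≼-trans h (up 2≤z k) = up 2≤z (≼-trans h k)

  ≼-comparable : ∀ {x y z} → x ≼ z → y ≼ z → x ≼ y ⊎ y ≼ x
  ≼-comparable here k = inj₂ k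
  ≼-comparable h@(up _ _) here = inj₁ h
  ≼-comparable (up _ h) (up _ k) = ≼-comparable h k

  _≼?_ : ∀ x y → Dec (x ≼ y)
  x ≼? y = go (suc y) ℕ.≤-refl
    where
    go : ∀ n {y} → y < n → Dec (x ≼ y)
    go (suc n) {y} (s≤s y≤n) with x ℕ.≟ y | 2 ℕ.≤? y
    ... | yes refl | _ = yes here
    ... | no x≢y | no 2≰y = no λ { here → x≢y refl ; (up 2≤y _) → 2≰y 2≤y }
    ... | no x≢y | yes 2≤y with go n (ℕ.<-≤-trans (par-<-2 2≤y) y≤n)
    ...   | yes h = yes (up 2≤y h)
    ...   | no h = no λ { here → x≢y refl ; (up _ k) → h k }

  ¬≼-par : ∀ {x a} → 1 ≤ x → 1 ≤ a → ¬ (x ≼ a) → ¬ (x ≼ par a)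
  ¬≼-par {a = suc zero} 1≤x 1≤a _ h =
    ℕ.<⇒≱ (par<′ 1≤a) (ℕ.≤-trans 1≤x (≼⇒≤ h))
  ¬≼-par {a = suc (suc a)} _ _ x⋠a h = x⋠a (up (s≤s (s≤s z≤n)) h)

  ≼-≢ : ∀ {x a y} → x ≼ y → ¬ (x ≼ a) → a ≢ y
  ≼-≢ x≼y x⋠a refl = x⋠a x≼y

  private
    [_,_,_] : ℕ → ℕ → ℕ → ℚ
    [ a , b , c ] = orient (position a) (position b) (position c)

    rotate : ∀ {a b c d e f} → Same [ b , c , a ] [ e , f , d ] → Same [ a , b , c ] [ d , e , f ]
    rotate {a} {b} {c} {d} {e} {f} = subst₂ Same
      (orient-rotate (position a) (position b) (position c))
      (orient-rotate (position d) (position e) (position f))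

    swap : ∀ {a b c d e f} → Same [ a , b , c ] [ d , e , f ] → Same [ b , a , c ] [ e , d , f ]
    swap {a} {b} {c} {d} {e} {f} h = subst₂ Same
      (sym (orient-swap (position a) (position b) (position c)))
      (sym (orient-swap (position d) (position e) (position f))) (Same-neg h)

  module _ {x} (1≤x : 1 ≤ x) where

    private
      SameSide : ℕ → ℕ → ℕ → Set
      SameSide a b y = a ≢ b → ¬ (x ≼ a) → ¬ (x ≼ b) → x ≼ y → Same [ a , b , y ] [ a , b , x ]

    -- The induction moves the largest of the three indices to its parent.
    same-side-step : ∀ {a b y} → b < a → y < a →
      (∀ {a′ b′} → a′ ℕ.+ b′ < a ℕ.+ b → SameSide a′ b′ y) → SameSide a b y
    same-side-step {a} {b} {y} b<a y<a ih a≢b x⋠a x⋠b x≼y with b ℕ.≟ par a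
    -- `via` exchanges the line ab for the line from `par a` to `b`, once at `y` and once at `x`.
    -- The rotation puts `a`, the latest point, last, as `like-parent` needs.
    ... | no b≢p = Same-trans (via y≢b y≢p y<a) (Same-trans
            (ih (ℕ.+-monoˡ-< b p<a) (≢-sym b≢p) x⋠p x⋠b x≼y)
            (Same-sym (via (≼-≢ here x⋠b) (≼-≢ here x⋠p) x<a)))
      where
      x<a = ℕ.≤-<-trans (≼⇒≤ x≼y) y<a
      2≤a = ℕ.≤-<-trans 1≤x x<a
      p<a = par-<-2 2≤a
      x⋠p = ¬≼-par 1≤x (ℕ.≤-trans 1≤x (ℕ.<⇒≤ x<a)) x⋠a
      y≢b = ≼-≢ x≼y x⋠b
      y≢p = ≼-≢ x≼y x⋠p
      via : ∀ {z} → b ≢ z → par a ≢ z → z < a → Same [ a , b , z ] [ par a , b , z ]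
      via {z} b≢z p≢z z<a = rotate {a} {b} {z} {par a} {b} {z}
        (Placed.like-parent (position-placed a) 2≤a b b<a z z<a (b≢z , b≢p , ≢-sym p≢z))
    -- Now `b` is the parent of `a`, and seen from there `a` behaves like its grandparent, so the
    -- new line joins `grand a` to `par a`.
    ... | yes refl = Same-trans (via (≼-≢ x≼y x⋠b) (≼-≢ x≼y x⋠q) y<a) (Same-trans
            (ih smaller (ℕ.<⇒≢ (grand<par 2≤a)) x⋠q x⋠b x≼y)
            (Same-sym (via (≼-≢ here x⋠b) (≼-≢ here x⋠q) x<a)))
      where
      x<a = ℕ.≤-<-trans (≼⇒≤ x≼y) y<a
      2≤a = ℕ.≤-<-trans 1≤x x<a
      x⋠q = ¬≼-par 1≤x (1≤par 2≤a) x⋠b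
      smaller : grand a ℕ.+ par a < a ℕ.+ par a
      smaller = ℕ.+-monoˡ-< (par a) (grand< 2≤a)
      via : ∀ {z} → par a ≢ z → grand a ≢ z → z < a → Same [ a , par a , z ] [ grand a , par a , z ]
      via {z} p≢z q≢z z<a = rotate {a} {par a} {z} {grand a} {par a} {z}
        (Placed.towards-grand (position-placed a) 2≤a z z<a (≢-sym p≢z , ≢-sym q≢z))

    same-side : ∀ {a b y} → SameSide a b y
    same-side {a} {b} {y} = go (suc (a ℕ.+ b ℕ.+ y)) ℕ.≤-refl
      where
      go : ∀ n {a b y} → a ℕ.+ b ℕ.+ y < n → SameSide a b y
      go (suc n) {a} {b} {y} (s≤s m≤n) a≢b x⋠a x⋠b x≼y with ℕ.<-cmp a y | ℕ.<-cmp b y | ℕ.<-cmp a b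
      ... | tri≈ _ a≡y _ | _ | _ = ⊥-elim (≼-≢ x≼y x⋠a a≡y)
      ... | _ | tri≈ _ b≡y _ | _ = ⊥-elim (≼-≢ x≼y x⋠b b≡y)
      ... | _ | _ | tri≈ _ a≡b _ = ⊥-elim (a≢b a≡b)
      ... | tri> _ _ y<a | _ | tri> _ _ b<a = same-side-step b<a y<a
        (λ h → go n (ℕ.<-≤-trans (ℕ.+-monoˡ-< y h) m≤n)) a≢b x⋠a x⋠b x≼y
      ... | _ | tri> _ _ y<b | tri< a<b _ _ = swap {b} {a} {y} {b} {a} {x} (same-side-step a<b y<b
        (λ {a′} {b′} h → go n (ℕ.<-≤-trans (ℕ.+-monoˡ-< y
          (subst (a′ ℕ.+ b′ <_) (ℕ.+-comm b a) h)) m≤n)) (≢-sym a≢b) x⋠b x⋠a x≼y)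
      ... | tri< a<y _ _ | tri> _ _ y<b | tri> _ _ b<a = ⊥-elim (ℕ.<-asym (ℕ.<-trans a<y y<b) b<a)
      ... | tri> _ _ y<a | tri< b<y _ _ | tri< a<b _ _ = ⊥-elim (ℕ.<-asym (ℕ.<-trans b<y y<a) a<b)
      -- Here `y` is the largest index. Climbing from `y` ends at `x` and never meets `a` or `b`,
      -- which are outside the subtree.
      ... | tri< a<y _ _ | tri< b<y _ _ | _ with x≼y
      ...   | here = Same-refl (position-general a≢b (ℕ.<⇒≢ a<y) (ℕ.<⇒≢ b<y))
      ...   | up 2≤y x≼p = Same-trans
        (Placed.like-parent (position-placed y) 2≤y a a<y b b<y (a≢b , ≼-≢ x≼p x⋠a , ≼-≢ x≼p x⋠b))
        (go n (ℕ.<-≤-trans (ℕ.+-monoʳ-< (a ℕ.+ b) (par-<-2 2≤y)) m≤n) a≢b x⋠a x⋠b x≼p)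

  -- By `same-side`, a line v′u′ that separates u from v has an end in the subtree of u. If that end
  -- is u′, then v′, lying below u′, is in the subtree as well.
  separated⇒≼ : ∀ {u v u′ v′} → 1 ≤ u → u ≼ v → u′ ≼ v′ → v′ ≢ u′ →
    ¬ Same [ v′ , u′ , v ] [ v′ , u′ , u ] → u ≼ v′
  separated⇒≼ {u} {v} {u′} {v′} 1≤u u≼v u′≼v′ v′≢u′ separated with u ≼? v′
  ... | yes u≼v′ = u≼v′
  ... | no u⋠v′ = ⊥-elim (separated
    (same-side 1≤u v′≢u′ u⋠v′ (λ u≼u′ → u⋠v′ (≼-trans u≼u′ u′≼v′)) u≼v))

  -- `On a b` stands for a fixed point lying on the line ab. The condition `nonconcurrent` is
  -- available only at the largest of the six indices, so each pair is written in descending order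
  -- and the pair with the largest index is moved to the distinguished place.
  module NoThree (On : ℕ → ℕ → Set) (On-sym : ∀ {a b} → On a b → On b a)
    (concurrent : ∀ {a b c d e f} → On a b → On c d → On e f →
      det (line (position c) (position d)) (line (position e) (position f))
          (line (position a) (position b)) ≡ 0ℚ) where

    private
      descending : ∀ {v a c d e f} → a < v → d < c → f < e → c ≤ v → e ≤ v →
        Apart v a c d → Apart v a e f → Apart c d e f → On v a → On c d → On e f → ⊥
      descending {v} {a} {c} {d} {e} {f} a<v d<c f<e c≤v e≤v
        (v≢c , v≢d , a≢c , a≢d) (v≢e , v≢f , a≢e , a≢f) (c≢e , c≢f , d≢e , d≢f) p q r =
        Placed.nonconcurrent (position-placed v) a a<v c c<v d (ℕ.<-trans d<c c<v)
          e e<v f (ℕ.<-trans f<e e<v)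
          (distinct₅ (≢-sym (ℕ.<⇒≢ d<c)) (≢-sym a≢c) (≢-sym a≢d) c≢e c≢f (≢-sym (ℕ.<⇒≢ f<e)))
          (concurrent p q r)
        where
        c<v = ℕ.≤∧≢⇒< c≤v (≢-sym v≢c)
        e<v = ℕ.≤∧≢⇒< e≤v (≢-sym v≢e)

      Apart-sym : ∀ {a b c d : ℕ} → Apart a b c d → Apart c d a b
      Apart-sym (p , q , r , s) = ≢-sym p , ≢-sym r , ≢-sym q , ≢-sym s

      Apart-swapˡ : ∀ {a b c d : ℕ} → Apart a b c d → Apart b a c d
      Apart-swapˡ (p , q , r , s) = r , s , p , q

      Apart-swapʳ : ∀ {a b c d : ℕ} → Apart a b c d → Apart a b d c
      Apart-swapʳ (p , q , r , s) = q , p , s , r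

      oriented : ∀ {a b c d e f} → b < a → d < c → f < e →
        Apart a b c d → Apart a b e f → Apart c d e f → On a b → On c d → On e f → ⊥
      oriented {a} {b} {c} {d} {e} {f} b<a d<c f<e x y z p q r
        with ℕ.≤-total a c | ℕ.≤-total c e | ℕ.≤-total a e
      ... | inj₂ c≤a | _ | inj₂ e≤a = descending b<a d<c f<e c≤a e≤a x y z p q r
      ... | inj₁ a≤c | inj₂ e≤c | _ = descending d<c b<a f<e a≤c e≤c (Apart-sym x) z y q p r
      ... | _ | inj₁ c≤e | inj₁ a≤e =
        descending f<e b<a d<c a≤e c≤e (Apart-sym y) (Apart-sym z) x r p q
      ... | inj₁ a≤c | inj₁ c≤e | inj₂ e≤a =
        descending f<e b<a d<c (ℕ.≤-trans a≤c c≤e) c≤e (Apart-sym y) (Apart-sym z) x r p q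
      ... | inj₂ c≤a | inj₂ e≤c | inj₁ a≤e =
        descending b<a d<c f<e c≤a (ℕ.≤-trans e≤c c≤a) x y z p q r

    private
      -- The principle of assuming without loss of generality that a pair is in descending order.
      either-way : ∀ {a b} (R : ℕ → ℕ → Set) → (∀ {a b} → R a b → R b a) →
        (∀ {a b} → b < a → R a b → ⊥) → a ≢ b → R a b → ⊥
      either-way {a} {b} R R-sym h a≢b r with ℕ.<-cmp b a
      ... | tri≈ _ b≡a _ = a≢b (sym b≡a)
      ... | tri< b<a _ _ = h b<a r
      ... | tri> _ _ a<b = h a<b (R-sym r)

    no-three : ∀ {a b c d e f} → a ≢ b → c ≢ d → e ≢ f →
      Apart a b c d → Apart a b e f → Apart c d e f → On a b → On c d → On e f → ⊥
    no-three {c = c} {d} {e} {f} a≢b c≢d e≢f x y z p q r = either-way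
      (λ a b → Apart a b c d × Apart a b e f × On a b)
      (λ (x , y , p) → Apart-swapˡ x , Apart-swapˡ y , On-sym p)
      (λ {a} {b} b<a (x , y , p) → either-way
        (λ c d → Apart a b c d × Apart c d e f × On c d)
        (λ (x , z , q) → Apart-swapʳ x , Apart-swapˡ z , On-sym q)
        (λ {c} {d} d<c (x , z , q) → either-way
          (λ e f → Apart a b e f × Apart c d e f × On e f)
          (λ (y , z , r) → Apart-swapʳ y , Apart-swapʳ z , On-sym r)
          (λ f<e (y , z , r) → oriented b<a d<c f<e x y z p q r)
          e≢f (y , z , r))
        c≢d (x , z , q))
      a≢b (x , y , p)

-- Real points on rational lines and segments.

module RealPlane where
  open import Data.Rational.Base using (_+_; _*_; _-_; -_; _<_; _≤_; ∣_∣)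
  open +-*-Solver
  open Sign
  open Plane

  Eventually : (ℕ → Set) → Set
  Eventually P = ∃[ N ] ∀ n → N ℕ.≤ n → P n

  eventually-× : ∀ {P Q : ℕ → Set} → Eventually P → Eventually Q → Eventually (λ n → P n × Q n)
  eventually-× (M , p) (N , q) = M ℕ.⊔ N , λ n h →
    p n (ℕ.m⊔n≤o⇒m≤o M N h) , q n (ℕ.m⊔n≤o⇒n≤o M N h)

  eventually-map : ∀ {P Q : ℕ → Set} → (∀ n → P n → Q n) → Eventually P → Eventually Q
  eventually-map f (N , p) = N , λ n h → f n (p n h)

  eventually-const : ∀ {P : Set} → Eventually (λ _ → P) → P
  eventually-const (N , p) = p N ℕ.≤-refl

  Null : (ℕ → ℚ) → Set
  Null s = ∀ ε → 0ℚ < ε → Eventually (λ n → ∣ s n ∣ < ε)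

  null-resp : ∀ {s t} → (∀ n → s n ≡ t n) → Null s → Null t
  null-resp s≡t h ε 0<ε = eventually-map (λ n → subst (λ z → ∣ z ∣ < ε) (s≡t n)) (h ε 0<ε)

  null-0 : ∀ {s} → (∀ n → s n ≡ 0ℚ) → Null s
  null-0 s≡0 ε 0<ε = 0 , λ n _ → subst (λ z → ∣ z ∣ < ε) (sym (s≡0 n)) 0<ε

  null-+ : ∀ {s t} → Null s → Null t → Null (λ n → s n + t n)
  null-+ {s} {t} h k ε 0<ε = eventually-map
    (λ n (p , q) → ℚ.≤-<-trans (ℚ.∣p+q∣≤∣p∣+∣q∣ (s n) (t n))
      (subst (∣ s n ∣ + ∣ t n ∣ <_) (½*+½* ε) (ℚ.+-mono-< p q)))
    (eventually-× (h (ℚ.½ * ε) (0<½* 0<ε)) (k (ℚ.½ * ε) (0<½* 0<ε)))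

  null-* : ∀ c {s} → Null s → Null (λ n → c * s n)
  null-* c {s} h ε 0<ε = go (divide M ε 0<M 0<ε)
    where
    -- The summand 1 makes `divide` applicable also when c = 0.
    M : ℚ
    M = ∣ c ∣ + 1ℚ
    c<M : ∣ c ∣ < M
    c<M = subst (_< M) (ℚ.+-identityʳ ∣ c ∣) (ℚ.+-monoʳ-< ∣ c ∣ (ℚ.positive⁻¹ 1ℚ))
    0<M : 0ℚ < M
    0<M = ℚ.≤-<-trans (ℚ.0≤∣p∣ c) c<M
    go : ∃[ δ ] (0ℚ < δ × M * δ ≡ ε) → Eventually (λ n → ∣ c * s n ∣ < ε)
    go (δ , 0<δ , Mδ≡ε) = eventually-map
      (λ n p → subst₂ _<_ (sym (ℚ.∣p*q∣≡∣p∣*∣q∣ c (s n))) Mδ≡ε (≤-*-< {c} {s n} c<M 0<M p))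
      (h δ 0<δ)

  null-neg : ∀ {s} → Null s → Null (λ n → - s n)
  null-neg {s} h ε 0<ε = eventually-map
    (λ n → subst (_< ε) (sym (ℚ.∣-p∣≡∣p∣ (s n)))) (h ε 0<ε)

  -- The way back to ℚ: when the approximations have cancelled from a null sequence, an exact
  -- rational equation remains.
  null-const : ∀ {c} → Null (λ _ → c) → c ≡ 0ℚ
  null-const {c} h with ℚ.<-cmp 0ℚ ∣ c ∣
  ... | tri< p _ _ = ⊥-elim (ℚ.<-irrefl refl (eventually-const (h ∣ c ∣ p)))
  ... | tri≈ _ e _ = ℚ.∣p∣≡0⇒p≡0 c (sym e)
  ... | tri> _ _ p = ⊥-elim (ℚ.<-irrefl refl (ℚ.<-≤-trans p (ℚ.0≤∣p∣ c)))

  embed : Pt → Point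
  embed (x , y) = fromℚ x , fromℚ y

  approx : Point → ℕ → Pt
  approx (x , y) n = seq x n , seq y n

  -- Incidence of a real point with a rational line, expressed through the approximations of the
  -- point so that all computation stays in ℚ.
  OnLine : Pt → Pt → Point → Set
  OnLine a b p = Null (λ n → orient a b (approx p n))

  OnLine-sym : ∀ {a b p} → OnLine a b p → OnLine b a p
  OnLine-sym {a} {b} {p} h = null-resp (λ n → sym (orient-swap a b (approx p n))) (null-neg h)

  ≡⇒≈ : ∀ {x y} → (∀ n → seq x n ≡ seq y n) → x ≈ y
  ≡⇒≈ {x} {y} e = mk≈ (null-0 {λ n → seq x n - seq y n}
    λ n → trans (cong (_- seq y n) (e n)) (ℚ.+-inverseʳ (seq y n)))

  fromℚ-injective : ∀ {a b} → fromℚ a ≈ fromℚ b → a ≡ b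
  fromℚ-injective h = p-q≡0⇒p≡q (null-const (eventually-close h))

  embed-injective : ∀ {a b} → embed a ≈ₚ embed b → a ≡ b
  embed-injective (h , k) = cong₂ _,_ (fromℚ-injective h) (fromℚ-injective k)

  collinear⇒orient≡0 : ∀ {a b c} → Collinear (embed a) (embed b) (embed c) → orient a b c ≡ 0ℚ
  collinear⇒orient≡0 {a , a′} {b , b′} {c , c′} h = trans
    (solve 6 (λ a a′ b b′ c c′ →
      (a′ :- b′) :* c :+ ((b :- a) :* c′ :+ (a :* b′ :- a′ :* b)) :=
      (b :- a) :* (c′ :- a′) :- (c :- a) :* (b′ :- a′)) refl a a′ b b′ c c′)
    (null-const (eventually-close h))

  ≈ₚ⇒null : ∀ l {p q} → p ≈ₚ q → Null (λ n → l ∙ approx p n - l ∙ approx q n)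
  ≈ₚ⇒null (α , β , γ) {x , y} {x′ , y′} (h , k) = null-resp
    (λ n → solve 7 (λ α β γ x y x′ y′ →
      α :* (x :- x′) :+ β :* (y :- y′) :=
      (α :* x :+ (β :* y :+ γ)) :- (α :* x′ :+ (β :* y′ :+ γ))) refl
      α β γ (seq x n) (seq y n) (seq x′ n) (seq y′ n))
    (null-+ (null-* α (eventually-close h)) (null-* β (eventually-close k)))

  segment : Pt → Pt → ℚ → Pt
  segment (a , a′) (b , b′) t = a + t * (b - a) , a′ + t * (b′ - a′)

  ∙-segment : ∀ l a b t → l ∙ segment a b t ≡ l ∙ a + t * (l ∙ b - l ∙ a)
  ∙-segment (α , β , γ) (a , a′) (b , b′) t = solve 8 (λ α β γ a a′ b b′ t →
    α :* (a :+ t :* (b :- a)) :+ (β :* (a′ :+ t :* (b′ :- a′)) :+ γ) :=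
    (α :* a :+ (β :* a′ :+ γ)) :+
      t :* ((α :* b :+ (β :* b′ :+ γ)) :- (α :* a :+ (β :* a′ :+ γ))))
    refl α β γ a a′ b b′ t

  onSegment⇒null : ∀ l {a b p} → ((t , _) : OnSegment (embed a) (embed b) p) →
    Null (λ n → l ∙ approx p n - (l ∙ a + seq t n * (l ∙ b - l ∙ a)))
  onSegment⇒null l {a} {b} {p} (t , _ , _ , p≈) = null-resp
    (λ n → cong (λ z → l ∙ approx p n - z) (∙-segment l a b (seq t n)))
    (≈ₚ⇒null l p≈)

  onSegment⇒onLine : ∀ {a b p} → OnSegment (embed a) (embed b) p → OnLine a b p
  onSegment⇒onLine {a} {b} {p} h@(t , _) = null-resp
    (λ n → trans (cong₂ (λ u v → orient a b (approx p n) - (u + seq t n * (v - u)))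
        (orient-aba a b) (orient-abb a b))
      (solve 2 (λ z t → z :- (con 0ℚ :+ t :* (con 0ℚ :- con 0ℚ)) := z) refl
        (orient a b (approx p n)) (seq t n)))
    (onSegment⇒null (line a b) h)

  private
    -- A + s(B - A) stays above A/2 once s ≥ -A/(2B).
    not-null : ∀ {A B} (s : ℕ → ℚ) → 0ℚ < A → A ≤ B →
      (∀ ε → 0ℚ < ε → Eventually (λ n → 0ℚ < s n + ε)) → ¬ Null (λ n → A + s n * (B - A))
    not-null {A} {B} s 0<A A≤B s≥0 h = go (divide B (ℚ.½ * A) 0<B (0<½* 0<A))
      where
      0<B : 0ℚ < B
      0<B = ℚ.<-≤-trans 0<A A≤B
      0≤B-A : 0ℚ ≤ B - A
      0≤B-A = subst (_≤ B - A) (ℚ.+-inverseʳ A) (ℚ.+-monoˡ-≤ (- A) A≤B)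
      go : ∃[ δ ] (0ℚ < δ × B * δ ≡ ℚ.½ * A) → ⊥
      go (δ , 0<δ , Bδ≡A/2) = eventually-const (eventually-map contra
        (eventually-× (s≥0 δ 0<δ) (h (ℚ.½ * A) (0<½* 0<A))))
        where
        contra : ∀ n → 0ℚ < s n + δ × ∣ A + s n * (B - A) ∣ < ℚ.½ * A → ⊥
        contra n (0<s+δ , small) = ℚ.<-irrefl refl (ℚ.≤-<-trans large (ℚ.≤-<-trans (x≤∣x∣ _) small))
          where
          open ℚ.≤-Reasoning
          large : ℚ.½ * A ≤ A + s n * (B - A)
          large = begin
            ℚ.½ * A ≡⟨ sym (ℚ.+-identityʳ _) ⟩
            ℚ.½ * A + 0ℚ ≤⟨ ℚ.+-monoʳ-≤ (ℚ.½ * A) (subst (_≤ (s n + δ) * (B - A) + A * δ)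
                (solve 1 (λ x → con 0ℚ :* x :+ con 0ℚ := con 0ℚ) refl (B - A))
                (ℚ.+-mono-≤ (ℚ.*-monoʳ-≤-nonNeg (B - A) {{ℚ.nonNegative 0≤B-A}} (ℚ.<⇒≤ 0<s+δ))
                  (ℚ.<⇒≤ (*-pos 0<A 0<δ)))) ⟩
            ℚ.½ * A + ((s n + δ) * (B - A) + A * δ)
              ≡⟨ solve 5 (λ h s d b a → h :+ ((s :+ d) :* (b :- a) :+ a :* d) :=
                   h :+ b :* d :+ s :* (b :- a)) refl (ℚ.½ * A) (s n) δ B A ⟩
            ℚ.½ * A + B * δ + s n * (B - A)
              ≡⟨ cong (_+ s n * (B - A)) (trans (cong (ℚ.½ * A +_) Bδ≡A/2) (½*+½* A)) ⟩
            A + s n * (B - A) ∎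

    not-null′ : ∀ {A B} t → 0ℚ < A → 0ℚ < B → 0ℝ Defs.≤ t → t Defs.≤ 1ℝ →
      ¬ Null (λ n → A + seq t n * (B - A))
    not-null′ {A} {B} t 0<A 0<B 0≤t t≤1 h with ℚ.≤-total A B
    ... | inj₁ A≤B = not-null (seq t) 0<A A≤B (eventually-below 0≤t) h
    -- Reversing the segment by t ↦ 1 - t puts the smaller of the two values at parameter 0.
    ... | inj₂ B≤A = not-null (λ n → 1ℚ - seq t n) 0<B B≤A
      (λ ε 0<ε → eventually-map (λ n t< → subst₂ _<_ (ℚ.+-inverseʳ (seq t n))
          (solve 2 (λ e t → (con 1ℚ :+ e) :- t := (con 1ℚ :- t) :+ e) refl ε (seq t n))
          (ℚ.+-monoˡ-< (- seq t n) t<))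
        (eventually-below t≤1 ε 0<ε))
      (null-resp (λ n → solve 3 (λ a b t → a :+ t :* (b :- a) := b :+ (con 1ℚ :- t) :* (a :- b))
        refl A B (seq t n)) h)

  -- On a segment the affine function interpolates between its values at the ends. If these have the
  -- same strict sign, it stays away from 0, whereas at p it tends to 0.
  separated : ∀ l {a b p} → OnSegment (embed a) (embed b) p → Null (λ n → l ∙ approx p n) →
    ¬ Same (l ∙ a) (l ∙ b)
  separated l {a} {b} {p} h@(t , 0≤t , t≤1 , _) lp s = go s
    where
    values : Null (λ n → l ∙ a + seq t n * (l ∙ b - l ∙ a))
    values = null-resp (λ n → solve 2 (λ x y → x :+ :- (x :- y) := y) refl
        (l ∙ approx p n) (l ∙ a + seq t n * (l ∙ b - l ∙ a)))
      (null-+ lp (null-neg (onSegment⇒null l h)))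
    go : ¬ Same (l ∙ a) (l ∙ b)
    go (inj₁ (p , q)) = not-null′ t p q 0≤t t≤1 values
    go (inj₂ (p , q)) = not-null′ t (ℚ.neg-antimono-< p) (ℚ.neg-antimono-< q) 0≤t t≤1
      (null-resp (λ n → solve 3 (λ a b t → :- (a :+ t :* (b :- a)) := :- a :+ t :* (:- b :- :- a))
        refl (l ∙ a) (l ∙ b) (seq t n)) (null-neg values))

  -- The determinant of the two normal vectors, which vanishes exactly for parallel directions.
  wronskian : Line → Line → ℚ
  wronskian (l₁ , l₂ , _) (m₁ , m₂ , _) = l₁ * m₂ - l₂ * m₁

  -- Both sides are the derivative of the affine function `l` in the direction d - c.
  wronskian-line : ∀ l c d → wronskian l (line c d) ≡ l ∙ d - l ∙ c
  wronskian-line (l₁ , l₂ , l₃) (c , c′) (d , d′) = solve 7 (λ l₁ l₂ l₃ c c′ d d′ →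
    l₁ :* (d :- c) :- l₂ :* (c′ :- d′) :=
    (l₁ :* d :+ (l₂ :* d′ :+ l₃)) :- (l₁ :* c :+ (l₂ :* c′ :+ l₃))) refl l₁ l₂ l₃ c c′ d d′

  -- Cramer's rule: the coordinates of p - x, multiplied by the determinant, are combinations of the
  -- two equations, hence null sequences.
  meet-unique : ∀ l m {p x} → wronskian l m ≢ 0ℚ →
    Null (λ n → l ∙ approx p n) → Null (λ n → m ∙ approx p n) →
    l ∙ x ≡ 0ℚ → m ∙ x ≡ 0ℚ → p ≈ₚ embed x
  meet-unique l@(l₁ , l₂ , l₃) m@(m₁ , m₂ , m₃) {p₁ , p₂} {x@(x₁ , x₂)} W≢0 lp mp lx mx =
    mk≈ (scaled {λ n → seq p₁ n - x₁} (null-resp (λ n → trans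
        (cong₂ (λ u v → m₂ * (l ∙ approx (p₁ , p₂) n - u) + - l₂ * (m ∙ approx (p₁ , p₂) n - v))
          (sym lx) (sym mx))
        (solve 10 (λ l₁ l₂ l₃ m₁ m₂ m₃ p₁ p₂ x₁ x₂ →
          m₂ :* ((l₁ :* p₁ :+ (l₂ :* p₂ :+ l₃)) :- (l₁ :* x₁ :+ (l₂ :* x₂ :+ l₃))) :+
          :- l₂ :* ((m₁ :* p₁ :+ (m₂ :* p₂ :+ m₃)) :- (m₁ :* x₁ :+ (m₂ :* x₂ :+ m₃))) :=
          (l₁ :* m₂ :- l₂ :* m₁) :* (p₁ :- x₁))
          refl l₁ l₂ l₃ m₁ m₂ m₃ (seq p₁ n) (seq p₂ n) x₁ x₂))
      (null-+ (null-* m₂ (minus-0 lp)) (null-* (- l₂) (minus-0 mp))))) ,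
    mk≈ (scaled {λ n → seq p₂ n - x₂} (null-resp (λ n → trans
        (cong₂ (λ u v → - m₁ * (l ∙ approx (p₁ , p₂) n - u) + l₁ * (m ∙ approx (p₁ , p₂) n - v))
          (sym lx) (sym mx))
        (solve 10 (λ l₁ l₂ l₃ m₁ m₂ m₃ p₁ p₂ x₁ x₂ →
          :- m₁ :* ((l₁ :* p₁ :+ (l₂ :* p₂ :+ l₃)) :- (l₁ :* x₁ :+ (l₂ :* x₂ :+ l₃))) :+
          l₁ :* ((m₁ :* p₁ :+ (m₂ :* p₂ :+ m₃)) :- (m₁ :* x₁ :+ (m₂ :* x₂ :+ m₃))) :=
          (l₁ :* m₂ :- l₂ :* m₁) :* (p₂ :- x₂))
          refl l₁ l₂ l₃ m₁ m₂ m₃ (seq p₁ n) (seq p₂ n) x₁ x₂))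
      (null-+ (null-* (- m₁) (minus-0 lp)) (null-* l₁ (minus-0 mp)))))
    where
    W : ℚ
    W = wronskian l m
    instance
      W-nonZero : ℚ.NonZero W
      W-nonZero = ℚ.≢-nonZero W≢0
    minus-0 : ∀ {s} → Null s → Null (λ n → s n - 0ℚ)
    minus-0 {s} = null-resp (λ n → sym (ℚ.+-identityʳ (s n)))
    scaled : ∀ {s} → Null (λ n → W * s n) → Null s
    scaled {s} h = null-resp (λ n → trans (sym (ℚ.*-assoc (ℚ.1/ W) W (s n)))
      (trans (cong (_* s n) (ℚ.*-inverseˡ W)) (ℚ.*-identityˡ (s n)))) (null-* (ℚ.1/ W) h)

  -- The third row of the adjugate matrix of (l , m , n) gives the combination.
  concurrent⇒det≡0 : ∀ l m k {p} → Null (λ n → l ∙ approx p n) → Null (λ n → m ∙ approx p n) →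
    Null (λ n → k ∙ approx p n) → det l m k ≡ 0ℚ
  concurrent⇒det≡0 l@(l₁ , l₂ , l₃) m@(m₁ , m₂ , m₃) k@(k₁ , k₂ , k₃) {p} lp mp kp = null-const
    (null-resp (λ n → solve 11 (λ l₁ l₂ l₃ m₁ m₂ m₃ k₁ k₂ k₃ x y →
        (m₁ :* k₂ :- m₂ :* k₁) :* (l₁ :* x :+ (l₂ :* y :+ l₃)) :+
        ((k₁ :* l₂ :- k₂ :* l₁) :* (m₁ :* x :+ (m₂ :* y :+ m₃)) :+
         (l₁ :* m₂ :- l₂ :* m₁) :* (k₁ :* x :+ (k₂ :* y :+ k₃))) :=
        (l₂ :* m₃ :- l₃ :* m₂) :* k₁ :+ ((l₃ :* m₁ :- l₁ :* m₃) :* k₂ :+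
          (l₁ :* m₂ :- l₂ :* m₁) :* k₃))
        refl l₁ l₂ l₃ m₁ m₂ m₃ k₁ k₂ k₃ (proj₁ (approx p n)) (proj₂ (approx p n)))
      (null-+ (null-* (m₁ * k₂ - m₂ * k₁) lp)
        (null-+ (null-* (k₁ * l₂ - k₂ * l₁) mp) (null-* (l₁ * m₂ - l₂ * m₁) kp))))

  Opposite : ℚ → ℚ → Set
  Opposite x y = (0ℚ < x × y < 0ℚ) ⊎ (x < 0ℚ × 0ℚ < y)

  opposite? : ∀ x y → Dec (Opposite x y)
  opposite? x y = (0ℚ ℚ.<? x ×-dec y ℚ.<? 0ℚ) ⊎-dec (x ℚ.<? 0ℚ ×-dec 0ℚ ℚ.<? y)

  ¬Same⇒Opposite : ∀ {x y} → x ≢ 0ℚ → y ≢ 0ℚ → ¬ Same x y → Opposite x y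
  ¬Same⇒Opposite {x} {y} x≢0 y≢0 h with ℚ.<-cmp 0ℚ x | ℚ.<-cmp 0ℚ y
  ... | tri≈ _ e _ | _ = ⊥-elim (x≢0 (sym e))
  ... | _ | tri≈ _ e _ = ⊥-elim (y≢0 (sym e))
  ... | tri< p _ _ | tri< q _ _ = ⊥-elim (h (inj₁ (p , q)))
  ... | tri< p _ _ | tri> _ _ q = inj₁ (p , q)
  ... | tri> _ _ p | tri< q _ _ = inj₂ (p , q)
  ... | tri> _ _ p | tri> _ _ q = ⊥-elim (h (inj₂ (p , q)))

  Opposite⇒≢0 : ∀ {x y} → Opposite x y → x ≢ 0ℚ × y ≢ 0ℚ
  Opposite⇒≢0 (inj₁ (p , q)) = ≢-sym (ℚ.<⇒≢ p) , ℚ.<⇒≢ q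
  Opposite⇒≢0 (inj₂ (p , q)) = ℚ.<⇒≢ p , ≢-sym (ℚ.<⇒≢ q)

  Opposite⇒difference≢0 : ∀ {x y} → Opposite x y → y - x ≢ 0ℚ
  Opposite⇒difference≢0 {x} {y} h e = go (p-q≡0⇒p≡q {y} {x} e) h
    where
    go : ∀ {x y} → y ≡ x → ¬ Opposite x y
    go refl (inj₁ (p , q)) = ℚ.<-asym p q
    go refl (inj₂ (p , q)) = ℚ.<-asym p q

  -- The junk value at 0 is 0.
  inverse : ℚ → ℚ
  inverse x with x ℚ.≟ 0ℚ
  ... | yes _ = 0ℚ
  ... | no x≢0 = ℚ.1/_ x {{ℚ.≢-nonZero x≢0}}

  inverse-* : ∀ {x} → x ≢ 0ℚ → inverse x * x ≡ 1ℚ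
  inverse-* {x} x≢0 with x ℚ.≟ 0ℚ
  ... | yes x≡0 = ⊥-elim (x≢0 x≡0)
  ... | no h = ℚ.*-inverseˡ x {{ℚ.≢-nonZero h}}

  -- A proper crossing in terms of four signs of rational numbers, which makes it decidable.
  Crosses : Pt → Pt → Pt → Pt → Set
  Crosses a b c d =
    Opposite (orient a b c) (orient a b d) × Opposite (orient c d a) (orient c d b)

  crosses? : ∀ a b c d → Dec (Crosses a b c d)
  crosses? a b c d = opposite? (orient a b c) (orient a b d) ×-dec
                     opposite? (orient c d a) (orient c d b)

  -- The solution t of u + t (v - u) = 0.
  parameter : ℚ → ℚ → ℚ
  parameter u v = - u * inverse (v - u)

  -- The point of the line cd on the line ab
  meet : Pt → Pt → Pt → Pt → Pt
  meet a b c d = segment c d (parameter (orient a b c) (orient a b d))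

  parameter-* : ∀ {u v} → Opposite u v → parameter u v * (v - u) ≡ - u
  parameter-* {u} {v} h = trans (ℚ.*-assoc (- u) (inverse (v - u)) (v - u))
    (trans (cong (- u *_) (inverse-* (Opposite⇒difference≢0 h))) (ℚ.*-identityʳ (- u)))

  parameter-≥0 : ∀ {u v} → Opposite u v → 0ℚ ≤ parameter u v
  parameter-≤1 : ∀ {u v} → Opposite u v → parameter u v ≤ 1ℚ
  parameter-≥0 {u} {v} h@(inj₂ (u<0 , 0<v)) = ℚ.*-cancelʳ-≤-pos (v - u) {{ℚ.positive 0<w}}
    (subst₂ _≤_ (sym (ℚ.*-zeroˡ (v - u))) (sym (parameter-* h)) (ℚ.<⇒≤ (ℚ.neg-antimono-< u<0)))
    where
    0<w : 0ℚ < v - u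
    0<w = ℚ.+-mono-< 0<v (ℚ.neg-antimono-< u<0)
  parameter-≥0 {u} {v} h@(inj₁ (0<u , v<0)) = ℚ.*-cancelʳ-≤-neg (v - u) {{ℚ.negative w<0}}
    (subst₂ _≤_ (sym (parameter-* h)) (sym (ℚ.*-zeroˡ (v - u))) (ℚ.<⇒≤ (ℚ.neg-antimono-< 0<u)))
    where
    w<0 : v - u < 0ℚ
    w<0 = ℚ.+-mono-< v<0 (ℚ.neg-antimono-< 0<u)
  parameter-≤1 {u} {v} h@(inj₂ (u<0 , 0<v)) = ℚ.*-cancelʳ-≤-pos (v - u) {{ℚ.positive 0<w}}
    (subst₂ _≤_ (trans (ℚ.+-identityˡ (- u)) (sym (parameter-* h))) (sym (ℚ.*-identityˡ (v - u)))
      (ℚ.+-monoˡ-≤ (- u) (ℚ.<⇒≤ 0<v)))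
    where
    0<w : 0ℚ < v - u
    0<w = ℚ.+-mono-< 0<v (ℚ.neg-antimono-< u<0)
  parameter-≤1 {u} {v} h@(inj₁ (0<u , v<0)) = ℚ.*-cancelʳ-≤-neg (v - u) {{ℚ.negative w<0}}
    (subst₂ _≤_ (sym (ℚ.*-identityˡ (v - u))) (trans (ℚ.+-identityˡ (- u)) (sym (parameter-* h)))
      (ℚ.+-monoˡ-≤ (- u) (ℚ.<⇒≤ v<0)))
    where
    w<0 : v - u < 0ℚ
    w<0 = ℚ.+-mono-< v<0 (ℚ.neg-antimono-< 0<u)

  ≤⇒≤ : ∀ {x y} → x ≤ y → fromℚ x Defs.≤ fromℚ y
  ≤⇒≤ {x} {y} x≤y = mk≤ λ ε 0<ε → 0 , λ _ _ → subst (_< y + ε) (ℚ.+-identityʳ x)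
    (ℚ.+-mono-≤-< x≤y 0<ε)

  meet-onSegment : ∀ {a b c d} → Opposite (orient a b c) (orient a b d) →
    OnSegment (embed c) (embed d) (embed (meet a b c d))
  meet-onSegment {a} {b} {c} {d} h = fromℚ (parameter (orient a b c) (orient a b d)) ,
    ≤⇒≤ (parameter-≥0 h) , ≤⇒≤ (parameter-≤1 h) , ≡⇒≈ (λ _ → refl) , ≡⇒≈ (λ _ → refl)

  ∙-meetˡ : ∀ {a b c d} → Opposite (orient a b c) (orient a b d) → orient a b (meet a b c d) ≡ 0ℚ
  ∙-meetˡ {a} {b} {c} {d} h = trans
    (∙-segment (line a b) c d (parameter (orient a b c) (orient a b d)))
    (trans (cong (orient a b c +_) (parameter-* h)) (ℚ.+-inverseʳ (orient a b c)))

  ∙-meetʳ : ∀ a b c d → orient c d (meet a b c d) ≡ 0ℚ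
  ∙-meetʳ a b c d = trans (∙-segment (line c d) c d t)
    (trans (cong₂ (λ u v → u + t * (v - u)) (orient-aba c d) (orient-abb c d))
      (solve 1 (λ t → con 0ℚ :+ t :* (con 0ℚ :- con 0ℚ) := con 0ℚ) refl t))
    where
    t = parameter (orient a b c) (orient a b d)

  crosses⇒≈meet : ∀ {a b c d p} → Crosses a b c d → OnLine a b p → OnLine c d p →
    p ≈ₚ embed (meet a b c d)
  crosses⇒≈meet {a} {b} {c} {d} (h , _) abp cdp = meet-unique (line a b) (line c d)
    (λ e → Opposite⇒difference≢0 h (trans (sym (wronskian-line (line a b) c d)) e))
    abp cdp (∙-meetˡ {a} {b} {c} {d} h) (∙-meetʳ a b c d)

  -- Both points lie on both lines, and these meet only once.
  meet-sym : ∀ {a b c d} → Crosses a b c d → meet c d a b ≡ meet a b c d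
  meet-sym {a} {b} {c} {d} h@(_ , h′) = embed-injective
    (crosses⇒≈meet {a} {b} {c} {d} h
    (null-0 λ _ → ∙-meetʳ c d a b) (null-0 λ _ → ∙-meetˡ {c} {d} {a} {b} h′))

  -- For two lines through a, the determinant required by `meet-unique` is `orient a b c`.
  star-meet : ∀ {a b c p} → orient a b c ≢ 0ℚ → OnLine a b p → OnLine a c p → p ≈ₚ embed a
  star-meet {a} {b} {c} h abp acp = meet-unique (line a b) (line a c)
    (λ e → h (trans (trans (solve 1 (λ x → x := x :- con 0ℚ) refl (orient a b c))
        (cong (λ z → orient a b c - z) (sym (orient-aba a b))))
      (trans (sym (wronskian-line (line a b) a c)) e)))
    abp acp (orient-aba a b) (orient-aba a c)

  onLine-rational : ∀ {a b p x} → p ≈ₚ embed x → OnLine a b p → orient a b x ≡ 0ℚ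
  onLine-rational {a} {b} {p} {x} p≈x abp = null-const (null-resp
    (λ n → solve 2 (λ u v → u :- (u :- v) := v) refl (orient a b (approx p n)) (orient a b x))
    (null-+ abp (null-neg (≈ₚ⇒null (line a b) p≈x))))

-- Rectilinear drawings on rational points and the enumeration of their crossings.

lookup-injective : {A : Set} {xs : List A} → Unique xs →
  ∀ {i j} → lookup xs i ≡ lookup xs j → i ≡ j
lookup-injective (_ ∷ _) {zero} {zero} _ = refl
lookup-injective {xs = _ ∷ xs} (x∉ ∷ _) {zero} {suc j} e =
  ⊥-elim (All.lookup x∉ (∈-lookup {xs = xs} j) e)
lookup-injective {xs = _ ∷ xs} (x∉ ∷ _) {suc i} {zero} e =
  ⊥-elim (All.lookup x∉ (∈-lookup {xs = xs} i) (sym e))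
lookup-injective (_ ∷ u) {suc i} {suc j} e = cong suc (lookup-injective u e)

module RationalDrawing (G : Graph)
  (at : Vertex G → Plane.Pt)
  (at-injective : ∀ {a b} → at a ≡ at b → a ≡ b)
  (general : ∀ {a b c} → a ≢ b → a ≢ c → b ≢ c → Plane.orient (at a) (at b) (at c) ≢ 0ℚ)
  (no-three : ∀ {a b c d e f p} → a ≢ b → c ≢ d → e ≢ f →
    Apart a b c d → Apart a b e f → Apart c d e f →
    RealPlane.OnLine (at a) (at b) p →
    RealPlane.OnLine (at c) (at d) p →
    RealPlane.OnLine (at e) (at f) p → ⊥) where
  open Sign
  open Plane
  open RealPlane
  open Graph G using (Adj; adj?; symm; irrefl)

  V : Set
  V = Vertex G

  On : V → V → Point → Set
  On a b p = OnLine (at a) (at b) p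

  share-or-apart : (e f : Pair {order G}) →
    (∃[ v ] (IsEnd v e × IsEnd v f)) ⊎ Apart (proj₁ e) (proj₂ e) (proj₁ f) (proj₂ f)
  share-or-apart (a , b) (c , d) with a Fin.≟ c | a Fin.≟ d | b Fin.≟ c | b Fin.≟ d
  ... | yes a≡c | _ | _ | _ = inj₁ (a , inj₁ refl , inj₁ a≡c)
  ... | _ | yes a≡d | _ | _ = inj₁ (a , inj₁ refl , inj₂ a≡d)
  ... | _ | _ | yes b≡c | _ = inj₁ (b , inj₂ refl , inj₁ b≡c)
  ... | _ | _ | _ | yes b≡d = inj₁ (b , inj₂ refl , inj₂ b≡d)
  ... | no p | no q | no r | no s = inj₂ (p , q , r , s)

  common-end : ∀ {v a b c d p} → a ≢ b → c ≢ d → ¬ SamePair (a , b) (c , d) →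
    IsEnd v (a , b) → IsEnd v (c , d) → On a b p → On c d p → p ≈ₚ embed (at v)
  common-end {v} {p = p} a≢b c≢d diff v∈ab v∈cd onab oncd = cases v∈ab v∈cd a≢b c≢d diff onab oncd
    where
    core : ∀ {x y} → v ≢ x → v ≢ y → x ≢ y → On v x p → On v y p → p ≈ₚ embed (at v)
    core {x} {y} v≢x v≢y x≢y = star-meet {at v} {at x} {at y} {p} (general v≢x v≢y x≢y)
    turn : ∀ {x y} → On x y p → On y x p
    turn {x} {y} = OnLine-sym {at x} {at y} {p}
    cases : ∀ {a b c d} → IsEnd v (a , b) → IsEnd v (c , d) → a ≢ b → c ≢ d →
      ¬ SamePair (a , b) (c , d) → On a b p → On c d p → p ≈ₚ embed (at v)
    cases (inj₁ refl) (inj₁ refl) a≢b c≢d diff h k = core a≢b c≢d (λ e → diff (inj₁ (refl , e))) h k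
    cases (inj₁ refl) (inj₂ refl) a≢b c≢d diff h k =
      core a≢b (≢-sym c≢d) (λ e → diff (inj₂ (refl , e))) h (turn k)
    cases (inj₂ refl) (inj₁ refl) a≢b c≢d diff h k =
      core (≢-sym a≢b) c≢d (λ e → diff (inj₂ (e , refl))) (turn h) k
    cases (inj₂ refl) (inj₂ refl) a≢b c≢d diff h k =
      core (≢-sym a≢b) (≢-sym c≢d) (λ e → diff (inj₁ (e , refl))) (turn h) (turn k)

  vertex-on-line : ∀ {v c d p} → c ≢ d → p ≈ₚ embed (at v) → On c d p → IsEnd v (c , d)
  vertex-on-line {v} {c} {d} {p} c≢d p≈v oncd with v Fin.≟ c | v Fin.≟ d
  ... | yes v≡c | _ = inj₁ v≡c
  ... | _ | yes v≡d = inj₂ v≡d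
  ... | no v≢c | no v≢d = ⊥-elim (general c≢d (≢-sym v≢c) (≢-sym v≢d)
    (onLine-rational {at c} {at d} {p} {at v} p≈v oncd))

  drawing : RectilinearDrawing G
  drawing = record
    { pos = λ v → embed (at v)
    ; distinct = λ {a} {b} h → at-injective (embed-injective {at a} {at b} h)
    ; noThreeCollinear = λ {a} {b} {c} a≢b a≢c b≢c h →
        general a≢b a≢c b≢c (collinear⇒orient≡0 {at a} {at b} {at c} h)
    ; noThreeConcurrent = λ {e} {f} {g} e! f! g! e≢f e≢g f≢g {p} pe pf pg →
        concurrent {e} {f} {g} e! f! g! e≢f e≢g f≢g {p}
          (onSegment⇒onLine {at (proj₁ e)} {at (proj₂ e)} {p} pe)
          (onSegment⇒onLine {at (proj₁ f)} {at (proj₂ f)} {p} pf)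
          (onSegment⇒onLine {at (proj₁ g)} {at (proj₂ g)} {p} pg)
    }
    where
    -- If two of the pairs share an end v, their lines meet only at v, so p is v and the third line
    -- passes through a vertex, which general position allows only at an end. If no two share an
    -- end, `no-three` applies.
    concurrent : ∀ {e f g : Pair} → proj₁ e ≢ proj₂ e → proj₁ f ≢ proj₂ f → proj₁ g ≢ proj₂ g →
      ¬ SamePair e f → ¬ SamePair e g → ¬ SamePair f g →
      ∀ {p} → On (proj₁ e) (proj₂ e) p → On (proj₁ f) (proj₂ f) p → On (proj₁ g) (proj₂ g) p →
      ∃[ v ] (IsEnd v e × IsEnd v f × IsEnd v g)
    concurrent {e} {f} {g} e! f! g! e≢f e≢g f≢g {p} pe pf pg
      with share-or-apart e f | share-or-apart e g | share-or-apart f g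
    ... | inj₁ (v , v∈e , v∈f) | _ | _ =
      v , v∈e , v∈f , vertex-on-line {v} {proj₁ g} {proj₂ g} {p} g!
        (common-end {v} {p = p} e! f! e≢f v∈e v∈f pe pf) pg
    ... | _ | inj₁ (v , v∈e , v∈g) | _ =
      v , v∈e , vertex-on-line {v} {proj₁ f} {proj₂ f} {p} f!
        (common-end {v} {p = p} e! g! e≢g v∈e v∈g pe pg) pf , v∈g
    ... | _ | _ | inj₁ (v , v∈f , v∈g) =
      v , vertex-on-line {v} {proj₁ e} {proj₂ e} {p} e!
        (common-end {v} {p = p} f! g! f≢g v∈f v∈g pf pg) pe , v∈f , v∈g
    ... | inj₂ x | inj₂ y | inj₂ z = ⊥-elim (no-three {p = p} e! f! g! x y z pe pf pg)

  open RectilinearDrawing drawing using (IsCrossing; CrossingCount)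

  EdgesCross : V × V × V × V → Set
  EdgesCross (a , b , c , d) = Adj a b × Adj c d × Crosses (at a) (at b) (at c) (at d)

  edgesCross? : ∀ q → Dec (EdgesCross q)
  edgesCross? (a , b , c , d) =
    adj? a b ×-dec adj? c d ×-dec crosses? (at a) (at b) (at c) (at d)

  meeting : V × V × V × V → Pt
  meeting (a , b , c , d) = meet (at a) (at b) (at c) (at d)

  -- A determinant with a repeated point is 0, so the strict signs already force the two edges to
  -- have no common end.
  edgesCross⇒crossing : ∀ {q} → EdgesCross q → IsCrossing (embed (meeting q))
  edgesCross⇒crossing {a , b , c , d} (ab , cd , X@(o , o′)) =
    (a , b) , (c , d) , ab , cd , different ,
    subst (λ x → OnSegment (embed (at a)) (embed (at b)) (embed x))
      (meet-sym {at a} {at b} {at c} {at d} X)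
      (meet-onSegment {at c} {at d} {at a} {at b} o′) ,
    meet-onSegment {at a} {at b} {at c} {at d} o , λ v v∈ab v∈cd _ → no-common v∈ab v∈cd
    where
    c∉ab : ¬ IsEnd c (a , b)
    c∉ab (inj₁ refl) = proj₁ (Opposite⇒≢0 o) (orient-aba (at a) (at b))
    c∉ab (inj₂ refl) = proj₁ (Opposite⇒≢0 o) (orient-abb (at a) (at b))
    d∉ab : ¬ IsEnd d (a , b)
    d∉ab (inj₁ refl) = proj₂ (Opposite⇒≢0 o) (orient-aba (at a) (at b))
    d∉ab (inj₂ refl) = proj₂ (Opposite⇒≢0 o) (orient-abb (at a) (at b))
    no-common : ∀ {v} → IsEnd v (a , b) → IsEnd v (c , d) → ⊥
    no-common v∈ab (inj₁ refl) = c∉ab v∈ab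
    no-common v∈ab (inj₂ refl) = d∉ab v∈ab
    different : ¬ SamePair (a , b) (c , d)
    different (inj₁ (refl , refl)) = c∉ab (inj₁ refl)
    different (inj₂ (refl , refl)) = c∉ab (inj₂ refl)

  record CrossAt (a b c d : V) (p : Point) : Set where
    constructor crossAt
    field
      cross-edges : EdgesCross (a , b , c , d)
      on-first  : On a b p
      on-second : On c d p

  module _ {a b c d p} (X : CrossAt a b c d p) where
    open CrossAt X
    crossAt-swap : CrossAt c d a b p
    crossAt-swap = let (ab , cd , o , o′) = cross-edges in
      crossAt (cd , ab , o′ , o) on-second on-first

    crossAt-flip : CrossAt b a c d p
    crossAt-flip = let (ab , cd , o , o′) = cross-edges in
      crossAt (symm ab , cd , flipped o , swapped o′)
        (OnLine-sym {at a} {at b} {p} on-first) on-second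
      where
      flipped : Opposite (orient (at a) (at b) (at c)) (orient (at a) (at b) (at d)) →
        Opposite (orient (at b) (at a) (at c)) (orient (at b) (at a) (at d))
      flipped o = subst₂ Opposite (sym (orient-swap (at a) (at b) (at c)))
        (sym (orient-swap (at a) (at b) (at d))) (negated o)
        where
        negated : ∀ {x y} → Opposite x y → Opposite (ℚ.- x) (ℚ.- y)
        negated (inj₁ (h , k)) = inj₂ (ℚ.neg-antimono-< h , ℚ.neg-antimono-< k)
        negated (inj₂ (h , k)) = inj₁ (ℚ.neg-antimono-< h , ℚ.neg-antimono-< k)
      swapped : ∀ {x y} → Opposite x y → Opposite y x
      swapped (inj₁ (h , k)) = inj₂ (k , h)
      swapped (inj₂ (h , k)) = inj₁ (k , h)

  -- A common end of the two edges would be p itself, which a crossing excludes. With four distinct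
  -- ends no sign is 0, and `separated` for each of the two segments makes the signs opposite.
  crossing⇒crossAt : ∀ {p} → IsCrossing p → ∃[ a ] ∃[ b ] ∃[ c ] ∃[ d ] CrossAt a b c d p
  crossing⇒crossAt {p} ((a , b) , (c , d) , ab , cd , diff , pab , pcd , no-end) =
    a , b , c , d , crossAt (ab , cd , opposite , opposite′) onab oncd
    where
    onab : On a b p
    onab = onSegment⇒onLine {at a} {at b} {p} pab
    oncd : On c d p
    oncd = onSegment⇒onLine {at c} {at d} {p} pcd
    loop : ∀ {x y} → Adj x y → x ≢ y
    loop xy refl = irrefl xy
    a≢b = loop ab
    c≢d = loop cd
    apart : Apart a b c d
    apart with share-or-apart (a , b) (c , d)
    ... | inj₁ (v , v∈ab , v∈cd) =
      ⊥-elim (no-end v v∈ab v∈cd (common-end a≢b c≢d diff v∈ab v∈cd onab oncd))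
    ... | inj₂ x = x
    opposite : Opposite (orient (at a) (at b) (at c)) (orient (at a) (at b) (at d))
    opposite = let (a≢c , a≢d , b≢c , b≢d) = apart in
      ¬Same⇒Opposite (general a≢b a≢c b≢c) (general a≢b a≢d b≢d)
        (separated (line (at a) (at b)) {at c} {at d} {p} pcd onab)
    opposite′ : Opposite (orient (at c) (at d) (at a)) (orient (at c) (at d) (at b))
    opposite′ = let (a≢c , a≢d , b≢c , b≢d) = apart in
      ¬Same⇒Opposite (general c≢d (≢-sym a≢c) (≢-sym a≢d)) (general c≢d (≢-sym b≢c) (≢-sym b≢d))
        (separated (line (at c) (at d)) {at a} {at b} {p} pab oncd)

  -- A crossing point needs only one representation in the list, in any order of edges and ends.
  -- Discarding false candidates and repeated points is decidable over ℚ and only shortens the list,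
  -- so its length bounds the exact count.
  module _ (candidates : List (V × V × V × V))
    (covered : ∀ {a b c d p} → CrossAt a b c d p →
      ∃[ a′ ] ∃[ b′ ] ∃[ c′ ] ∃[ d′ ] (CrossAt a′ b′ c′ d′ p × (a′ , b′ , c′ , d′) ∈ candidates))
    where

    private
      _≟ₚ_ = ≡-dec ℚ._≟_ ℚ._≟_

      found : List Pt
      found = map meeting (filter edgesCross? candidates)

      points : List Pt
      points = deduplicate _≟ₚ_ found

    crossings : CrossingCount (length points)
    crossings = record
      { crossing = λ i → embed (lookup points i)
      ; sound = λ i → sound (∈-lookup {xs = points} i)
      ; injective = λ {i} {j} h → lookup-injective (Unique.deduplicate-! _≟ₚ_ found)
          (embed-injective {lookup points i} {lookup points j} h)
      ; complete = λ h → let (_ , _ , _ , _ , X) = crossing⇒crossAt h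
                             (_ , _ , _ , _ , Y , q∈) = covered X in complete Y q∈ }
      where
      sound : ∀ {x} → x ∈ points → IsCrossing (embed x)
      sound x∈ with ∈-map⁻ meeting (∈-deduplicate⁻ _≟ₚ_ found x∈)
      ... | q , q∈ , refl = edgesCross⇒crossing (proj₂ (∈-filter⁻ edgesCross? {xs = candidates} q∈))
      complete : ∀ {a b c d p} → CrossAt a b c d p → (a , b , c , d) ∈ candidates →
        ∃[ i ] p ≈ₚ embed (lookup points i)
      complete {a} {b} {c} {d} {p} (crossAt (ab , cd , X) onab oncd) q∈ = Any.index x∈ ,
        subst (λ x → p ≈ₚ embed x) (lookup-index x∈)
          (crosses⇒≈meet {at a} {at b} {at c} {at d} X onab oncd)
        where
        x∈ : meeting (a , b , c , d) ∈ points
        x∈ = ∈-deduplicate⁺ _≟ₚ_ (∈-map⁺ meeting (∈-filter⁺ edgesCross? q∈ (ab , cd , X)))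

    crossings-bound : length points ℕ.≤ length candidates
    crossings-bound = ℕ.≤-trans (length-deduplicate _≟ₚ_ found)
      (ℕ.≤-trans (ℕ.≤-reflexive (length-map meeting (filter edgesCross? candidates)))
        (length-filter edgesCross? candidates))

    crossing-number-bound : ∃[ m ] (CrossingCount m × m ℕ.≤ length candidates)
    crossing-number-bound = length points , crossings , crossings-bound

-- Rooting a tree by the distance from a node.

least : {P : ℕ → Set} → Decidable P → ∀ {n} → P n → ∃[ m ] (P m × (∀ {k} → P k → m ℕ.≤ k))
least P? {zero} p = zero , p , λ _ → z≤n
least {P} P? {suc n} p with P? zero
... | yes p₀ = zero , p₀ , λ _ → z≤n
... | no ¬p₀ with least (λ n → P? (suc n)) p
...   | m , pm , minimal = suc m , pm ,
  λ { {zero} p₀ → ⊥-elim (¬p₀ p₀) ; {suc k} pk → s≤s (minimal pk) }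

module SimplePaths {n : ℕ} (R : Rel (Fin n) 0ℓ) where

  record SimplePath (s t : Fin n) : Set where
    field
      size      : ℕ
      vertex    : Fin (suc size) → Fin n
      first     : vertex zero ≡ s
      last      : vertex (fromℕ size) ≡ t
      step      : ∀ i → R (vertex (inject₁ i)) (vertex (suc i))
      injective : Injective _≡_ _≡_ vertex

  suffix : ∀ {t} size (vertex : Fin (suc size) → Fin n) → vertex (fromℕ size) ≡ t →
    (∀ i → R (vertex (inject₁ i)) (vertex (suc i))) → Injective _≡_ _≡_ vertex →
    ∀ i → SimplePath (vertex i) t
  suffix size vertex last step inj zero = record
    { size = size ; vertex = vertex ; first = refl ; last = last ; step = step ; injective = inj }
  suffix (suc size) vertex last step inj (suc i) =
    suffix size (vertex ∘ suc) last (step ∘ suc) (λ e → Fin.suc-injective (inj e)) i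

  -- If the new first node already occurs in the path, the part before that occurrence is dropped.
  prepend : ∀ {s s′ t} → R s s′ → SimplePath s′ t → SimplePath s t
  prepend {s} {s′} {t} r P with Fin.any? (λ i → SimplePath.vertex P i Fin.≟ s)
  ... | yes (i , refl) = suffix size vertex last step injective i
    where open SimplePath P
  ... | no fresh = record
    { size = suc size ; vertex = vertex′ ; first = refl ; last = last
    ; step = λ { zero → subst (R s) (sym first) r ; (suc i) → step i }
    ; injective = λ { {zero} {zero} _ → refl
                    ; {zero} {suc j} e → ⊥-elim (fresh (j , sym e))
                    ; {suc i} {zero} e → ⊥-elim (fresh (i , e))
                    ; {suc i} {suc j} e → cong suc (injective e) } }
    where
    open SimplePath P
    vertex′ : Fin (suc (suc size)) → Fin n
    vertex′ zero = s
    vertex′ (suc i) = vertex i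

  erase-loops : ∀ {s t} → Star R s t → SimplePath s t
  erase-loops {s} Closure.ε = record
    { size = 0 ; vertex = λ _ → s ; first = refl ; last = refl ; step = λ ()
    ; injective = λ { {zero} {zero} _ → refl } }
  erase-loops (r ◅ rs) = prepend r (erase-loops rs)

module RootedTree (T : Graph) (tree : IsTree T) where
  open Graph T using (Adj; adj?; symm; irrefl)

  Node : Set
  Node = Vertex T

  root : Node
  root = proj₁ (proj₁ tree)

  Reach : ℕ → Node → Set
  Reach zero t = t ≡ root
  Reach (suc n) t = ∃[ s ] (Adj s t × Reach n s)

  reach? : ∀ n t → Dec (Reach n t)
  reach? zero t = t Fin.≟ root
  reach? (suc n) t = Fin.any? (λ s → adj? s t ×-dec reach? n s)

  reachable : ∀ t → ∃[ n ] Reach n t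
  reachable t = go zero refl (proj₂ (proj₁ tree) root t)
    where
    go : ∀ {s} n → Reach n s → Star Adj s t → ∃[ m ] Reach m t
    go n r Closure.ε = n , r
    go n r (a ◅ as) = go (suc n) (_ , a , r) as

  abstract
    distance : ∀ t → ∃[ n ] (Reach n t × (∀ {m} → Reach m t → n ℕ.≤ m))
    distance t = least (λ n → reach? n t) (proj₂ (reachable t))

  level : Node → ℕ
  level t = proj₁ (distance t)

  level-reach : ∀ t → Reach (level t) t
  level-reach t = proj₁ (proj₂ (distance t))

  level-least : ∀ {n t} → Reach n t → level t ℕ.≤ n
  level-least {t = t} = proj₂ (proj₂ (distance t))

  private
    parent : ∀ n t → Reach n t → Node
    parent zero t _ = t
    parent (suc n) t (s , _) = s

  up : Node → Node
  up t = parent (level t) t (level-reach t)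

  -- The inequality of levels excludes the root, which `up` sends to itself.
  IsParent : Node → Node → Set
  IsParent s t = up t ≡ s × level s ℕ.< level t

  up-parent : ∀ t → t ≡ root ⊎ (Adj (up t) t × IsParent (up t) t)
  up-parent t = go (level t) (level-reach t)
    where
    go : ∀ n (r : Reach n t) →
      t ≡ root ⊎ (Adj (parent n t r) t × up t ≡ parent (level t) t (level-reach t) ×
        level (parent n t r) ℕ.< n)
    go zero r = inj₁ r
    go (suc n) (s , a , r) = inj₂ (a , refl , s≤s (level-least r))

  TreeEdge : Rel Node 0ℓ
  TreeEdge s t = Adj s t × (IsParent s t ⊎ IsParent t s)

  treeEdge? : ∀ s t → Dec (IsParent s t ⊎ IsParent t s)
  treeEdge? s t = (up t Fin.≟ s ×-dec level s ℕ.<? level t) ⊎-dec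
                  (up s Fin.≟ t ×-dec level t ℕ.<? level s)

  open SimplePaths TreeEdge

  to-root : ∀ t → Star TreeEdge t root × Star TreeEdge root t
  to-root t = go (suc (level t)) ℕ.≤-refl
    where
    go : ∀ n {t} → level t ℕ.< n → Star TreeEdge t root × Star TreeEdge root t
    go (suc n) {t} (s≤s h) with up-parent t
    ... | inj₁ refl = Closure.ε , Closure.ε
    ... | inj₂ (a , par) = let (down , above) = go n (ℕ.<-≤-trans (proj₂ par) h) in
      (symm a , inj₂ par) ◅ down , above ◅◅ ((a , inj₁ par) ◅ Closure.ε)

  -- A non-tree edge would close the tree path between its ends to a cycle.
  edge-parent : ∀ {s t} → Adj s t → IsParent s t ⊎ IsParent t s
  edge-parent {s} {t} a with treeEdge? s t
  ... | yes e = e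
  ... | no ¬e = ⊥-elim (close (erase-loops (proj₁ (to-root s) ◅◅ proj₂ (to-root t))))
    where
    go : ∀ size (vertex : Fin (suc size) → Node) → vertex zero ≡ s → vertex (fromℕ size) ≡ t →
      (∀ i → TreeEdge (vertex (inject₁ i)) (vertex (suc i))) → Injective _≡_ _≡_ vertex → ⊥
    -- A path of length 0 would make the edge a loop, and one of length 1 would make it a tree edge.
    -- From length 2 on there are at least three nodes, so the edge closes a genuine cycle.
    go zero vertex refl refl step inj = irrefl a
    go (suc zero) vertex refl refl step inj = ¬e (proj₂ (step zero))
    go (suc (suc l)) vertex refl refl step inj = proj₂ tree (record
      { l = l ; vertex = vertex ; injective = inj ; step = λ i → proj₁ (step i) ; close = symm a })
    close : ¬ SimplePath s t
    close P = go size vertex first last step injective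
      where open SimplePath P

  level≡0⇒root : ∀ {t} → level t ≡ 0 → t ≡ root
  level≡0⇒root {t} e = subst (λ n → Reach n t) e (level-reach t)

  level-root : level root ≡ 0
  level-root = ℕ.n≤0⇒n≡0 (level-least {0} refl)

-- The elimination order of a tree decomposition and its back neighbours.

≤-maximum : ∀ {n} (f : Fin n → ℕ) i → f i ℕ.≤ maximum f
≤-maximum f zero = ℕ.m≤m⊔n (f zero) _
≤-maximum f (suc i) = ℕ.≤-trans (≤-maximum (f ∘ suc) i) (ℕ.m≤n⊔m (f zero) _)

length-≤-∣∣ : ∀ {n} {xs : List (Fin n)} {p : Subset n} → Unique xs → All (Subset._∈ p) xs →
  length xs ℕ.≤ Subset.∣ p ∣
length-≤-∣∣ {xs = []} _ _ = z≤n
length-≤-∣∣ {xs = x ∷ xs} {p} (x∉xs ∷ unique) (x∈p All.∷ xs⊆p) = ℕ.≤-trans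
  (s≤s (length-≤-∣∣ unique (All.zipWith
    (λ (y∈p , x≢y) → Subset.x∈p∧x≢y⇒x∈p-y y∈p (≢-sym x≢y)) (xs⊆p , x∉xs))))
  (Subset.x∈p⇒∣p-x∣<∣p∣ x∈p)

module Elimination {G : Graph} (D : TreeDecomposition G) where
  open TreeDecomposition D
  open RootedTree tree isTree
  open Graph G using (Adj)

  private
    V : Set
    V = Vertex G

  abstract
    highest : ∀ v → ∃[ n ] ((∃[ t ] (level t ≡ n × v Subset.∈ bag t)) ×
      (∀ {m} → (∃[ t ] (level t ≡ m × v Subset.∈ bag t)) → n ℕ.≤ m))
    highest v = let (t , v∈t) = coversVertices v in
      least (λ n → Fin.any? (λ t → level t ℕ.≟ n ×-dec v Subset.∈? bag t)) (t , refl , v∈t)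

  top : V → Node
  top v = proj₁ (proj₁ (proj₂ (highest v)))

  ∈-top : ∀ v → v Subset.∈ bag (top v)
  ∈-top v = proj₂ (proj₂ (proj₁ (proj₂ (highest v))))

  level-top : ∀ {v t} → v Subset.∈ bag t → level (top v) ℕ.≤ level t
  level-top {v} {t} v∈t = let (n , (s , e , _) , minimal) = highest v in
    ℕ.≤-trans (ℕ.≤-reflexive e) (minimal (t , refl , v∈t))

  data Under (t : Node) : Node → Set where
    self  : Under t t
    below : ∀ {s} → level (up s) ℕ.< level s → Under t (up s) → Under t s

  under-level : ∀ {t s} → Under t s → t ≡ s ⊎ level t ℕ.< level s
  under-level self = inj₁ refl
  under-level (below h u) with under-level u
  ... | inj₁ refl = inj₂ h
  ... | inj₂ k = inj₂ (ℕ.<-trans k h)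

  -- A walk that avoids the parent of its first node stays in the subtree of that node.
  stays-under : ∀ {v t s s′} → ¬ v Subset.∈ bag (up t) → Under t s → Star (AdjAt v) s s′ →
    Under t s′
  stays-under _ u Closure.ε = u
  stays-under {v} {t} {s} h u (_◅_ {j = r} (a , _ , v∈r) w) =
    stays-under h (move u (edge-parent a)) w
    where
    move : Under t s → IsParent s r ⊎ IsParent r s → Under t r
    move u (inj₁ (refl , k)) = below k u
    move self (inj₂ (refl , _)) = ⊥-elim (h v∈r)
    move (below _ u) (inj₂ (refl , _)) = u

  -- If the parent bag missed v, the walk from t to `top v` through bags containing v would stay
  -- under t, so `top v` would be t itself or deeper than t, although its level is minimal.
  ∈-up : ∀ {v t} → v Subset.∈ bag t → t ≢ top v →
    v Subset.∈ bag (up t) × level (up t) ℕ.< level t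
  ∈-up {v} {t} v∈t t≢top with v Subset.∈? bag (up t) | up-parent t
  ... | _ | inj₁ refl = ⊥-elim (t≢top (sym (level≡0⇒root (ℕ.n≤0⇒n≡0
        (ℕ.≤-trans (level-top v∈t) (ℕ.≤-reflexive level-root))))))
  ... | yes v∈up | inj₂ (_ , _ , h) = v∈up , h
  ... | no v∉up | _ with under-level (stays-under v∉up self (connectedAt v v∈t (∈-top v)))
  ...   | inj₁ e = ⊥-elim (t≢top e)
  ...   | inj₂ h = ⊥-elim (ℕ.<⇒≱ h (level-top v∈t))

  -- Climb from t to `top v`, using `∈-up` for both vertices. The node `top u` cannot come first:
  -- the node above it would still contain v, so `top v` would have a smaller level than `top u`.
  share⇒∈-top : ∀ {u v t} → u Subset.∈ bag t → v Subset.∈ bag t →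
    level (top u) ℕ.≤ level (top v) → u Subset.∈ bag (top v)
  share⇒∈-top {u} {v} {t} = go (suc (level t)) ℕ.≤-refl
    where
    go : ∀ n {t} → level t ℕ.< n → u Subset.∈ bag t → v Subset.∈ bag t →
      level (top u) ℕ.≤ level (top v) → u Subset.∈ bag (top v)
    go (suc n) {t} (s≤s h) u∈t v∈t u≤v with t Fin.≟ top v
    ... | yes refl = u∈t
    ... | no t≢top = go n (ℕ.<-≤-trans lower h) (proj₁ (∈-up u∈t t≢top′)) v∈up u≤v
      where
      v∈up = proj₁ (∈-up v∈t t≢top)
      lower = proj₂ (∈-up v∈t t≢top)
      t≢top′ : t ≢ top u
      t≢top′ refl = ℕ.<⇒≱ (ℕ.≤-<-trans (level-top v∈up) lower) u≤v

  -- The lexicographic order of level and vertex number as one number, since vertex numbers are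
  -- below `order G`.
  key : V → ℕ
  key v = level (top v) ℕ.* order G ℕ.+ toℕ v

  key-level : ∀ {u v} → key u ℕ.≤ key v → level (top u) ℕ.≤ level (top v)
  key-level {u} {v} h with ℕ.≤-<-connex (level (top u)) (level (top v))
  ... | inj₁ k = k
  ... | inj₂ k = ⊥-elim (ℕ.<⇒≱ key< h)
    where
    open ℕ.≤-Reasoning
    key< : key v ℕ.< key u
    key< = begin-strict
      level (top v) ℕ.* order G ℕ.+ toℕ v <⟨ ℕ.+-monoʳ-< _ (Fin.toℕ<n v) ⟩
      level (top v) ℕ.* order G ℕ.+ order G ≡⟨ ℕ.+-comm _ (order G) ⟩
      suc (level (top v)) ℕ.* order G ≤⟨ ℕ.*-monoˡ-≤ (order G) k ⟩
      level (top u) ℕ.* order G ≤⟨ ℕ.m≤m+n _ (toℕ u) ⟩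
      key u ∎

  key-injective : ∀ {u v} → key u ≡ key v → u ≡ v
  key-injective {u} {v} e = Fin.toℕ-injective (ℕ.+-cancelˡ-≡ (level (top v) ℕ.* order G) _ _
    (trans (cong (λ l → l ℕ.* order G ℕ.+ toℕ u) (sym levels)) e))
    where
    levels : level (top u) ≡ level (top v)
    levels = ℕ.≤-antisym (key-level {u} {v} (ℕ.≤-reflexive e))
      (key-level {v} {u} (ℕ.≤-reflexive (sym e)))

  -- u precedes v and is adjacent to it in the chordal completion.
  Back : V → V → Set
  Back u v = u Subset.∈ bag (top v) × key u ℕ.< key v

  share⇒Back : ∀ {u v t} → u Subset.∈ bag t → v Subset.∈ bag t → key u ℕ.< key v → Back u v
  share⇒Back {u} {v} u∈t v∈t h = share⇒∈-top u∈t v∈t (key-level {u} {v} (ℕ.<⇒≤ h)) , h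

  Back-adjacent : ∀ {u v} → Adj u v → Back u v ⊎ Back v u
  Back-adjacent {u} {v} a with coversEdges a | ℕ.<-cmp (key u) (key v)
  ... | t , u∈t , v∈t | tri< h _ _ = inj₁ (share⇒Back u∈t v∈t h)
  ... | t , u∈t , v∈t | tri> _ _ h = inj₂ (share⇒Back v∈t u∈t h)
  ... | _ | tri≈ _ e _ = ⊥-elim (Graph.irrefl G (subst (Adj u) (sym (key-injective e)) a))

  -- The bag at `top x` contains both a and b.
  Back-clique : ∀ {a b x} → Back a x → Back b x → key a ℕ.< key b → Back a b
  Back-clique (a∈x , _) (b∈x , _) h = share⇒Back a∈x b∈x h

  back? : ∀ v u → Dec (Back u v)
  back? v u = u Subset.∈? bag (top v) ×-dec key u ℕ.<? key v

  backs : V → List V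
  backs v = filter (back? v) (allFin (order G))

  ∈-backs : ∀ {u v} → Back u v → u ∈ backs v
  ∈-backs {u} {v} = ∈-filter⁺ (back? v) (∈-allFin u)

  ∈-backs⁻ : ∀ {u v} → u ∈ backs v → Back u v
  ∈-backs⁻ {v = v} u∈ = proj₂ (∈-filter⁻ (back? v) {xs = allFin (order G)} u∈)

  -- Besides its back neighbours, the bag at `top v` contains v, which accounts for the 1 subtracted
  -- in `width`.
  length-backs : ∀ v → length (backs v) ℕ.≤ width
  length-backs v = ℕ.∸-monoˡ-≤ 1 (ℕ.≤-trans
    (length-≤-∣∣ {xs = v ∷ backs v}
      (All.tabulate (λ { x∈ refl → ℕ.<-irrefl refl (proj₂ (∈-backs⁻ x∈)) }) ∷
        Unique′.filter⁺ (back? v) (Unique′.allFin⁺ (order G)))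
      (∈-top v All.∷ All.tabulate (λ x∈ → proj₁ (∈-backs⁻ x∈))))
    (≤-maximum (λ t → Subset.∣ bag t ∣) (top v)))

-- The drawing given by a tree decomposition and the count of its crossings.

length-concatMap : {A B : Set} (f : A → List B) (xs : List A) {c : ℕ} →
  (∀ x → length (f x) ℕ.≤ c) → length (concatMap f xs) ℕ.≤ length xs ℕ.* c
length-concatMap f [] h = z≤n
length-concatMap f (x ∷ xs) h = ℕ.≤-trans (ℕ.≤-reflexive (length-++ (f x)))
  (ℕ.+-mono-≤ (h x) (length-concatMap f xs h))

∈-concatMap : {A B : Set} {f : A → List B} {xs : List A} {x : A} {y : B} →
  x ∈ xs → y ∈ f x → y ∈ concatMap f xs
∈-concatMap {f = f} x∈xs y∈fx = ∈-concatMap⁺ f (lose x∈xs y∈fx)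

module TreewidthDrawing {G : Graph} (D : TreeDecomposition G) where
  open Elimination D
  open Graph G using (Adj; adj?; symm)
  open TreeDecomposition D using (width)

  private
    V : Set
    V = Vertex G

  -- The indices 0 and 1 are the two initial points of the placement.
  index : V → ℕ
  index v = 2 ℕ.+ key v

  index-injective : ∀ {u v} → index u ≡ index v → u ≡ v
  index-injective e = key-injective (ℕ.suc-injective (ℕ.suc-injective e))

  -- The default 1 hangs a vertex without back neighbours from the second auxiliary point.
  latest : V → ℕ
  latest v = Extrema.max 1 (map index (backs v))

  1≤latest : ∀ v → 1 ℕ.≤ latest v
  1≤latest v = Extrema.⊥≤max 1 (map index (backs v))

  latest< : ∀ v → latest v ℕ.< index v
  latest< v = Extrema.max<v⁺ (s≤s (s≤s z≤n)) (All.tabulate bound)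
    where
    bound : ∀ {i} → i ∈ map index (backs v) → i ℕ.< index v
    bound i∈ with ∈-map⁻ index i∈
    ... | u , u∈ , refl = s≤s (s≤s (proj₂ (∈-backs⁻ u∈)))

  ≤latest : ∀ {u v} → Back u v → index u ℕ.≤ latest v
  ≤latest {u} {v} h = All.lookup (Extrema.xs≤max 1 (map index (backs v))) (∈-map⁺ index (∈-backs h))

  -- Back neighbours of v form a clique, so each of them other than the latest is a back neighbour
  -- of the latest.
  latest-Back : ∀ {u v} → Back u v →
    index u ≡ latest v ⊎ ∃[ w ] (index w ≡ latest v × Back u w)
  latest-Back {u} {v} h
    with ℕ.m≤n⇒m<n∨m≡n (≤latest h) | Extrema.argmax-sel id 1 (map index (backs v))
  ... | inj₂ e | _ = inj₁ e
  -- The maximum cannot be the default 1, because it exceeds the index of u.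
  ... | inj₁ lt | inj₁ e = ⊥-elim (ℕ.<⇒≱ (subst (index u ℕ.<_) e lt) (s≤s z≤n))
  ... | inj₁ lt | inj₂ l∈ with ∈-map⁻ index l∈
  ...   | w , w∈ , e = inj₂ (w , sym e ,
    Back-clique h (∈-backs⁻ w∈) (ℕ.≤-pred (ℕ.≤-pred (subst (index u ℕ.<_) e lt))))

  -- Keys leave gaps, and indices that belong to no vertex are placed too. These values satisfy
  -- `par-<` and `par-pos` for them and for the auxiliary indices.
  fallback : ℕ → ℕ
  fallback zero = 0
  fallback (suc zero) = 0
  fallback (suc (suc _)) = 1

  par : ℕ → ℕ
  par i with Fin.any? (λ v → index v ℕ.≟ i)
  ... | yes (v , _) = latest v
  ... | no _ = fallback i

  par-< : ∀ i → par (suc i) ℕ.< suc i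
  par-< i with Fin.any? (λ v → index v ℕ.≟ suc i)
  ... | yes (v , e) = subst (latest v ℕ.<_) e (latest< v)
  par-< zero | no _ = s≤s z≤n
  par-< (suc i) | no _ = s≤s (s≤s z≤n)

  par-pos : ∀ i → 1 ℕ.≤ par (2 ℕ.+ i)
  par-pos i with Fin.any? (λ v → index v ℕ.≟ 2 ℕ.+ i)
  ... | yes (v , _) = 1≤latest v
  ... | no _ = s≤s z≤n

  par-index : ∀ v → par (index v) ≡ latest v
  par-index v with Fin.any? (λ u → index u ℕ.≟ index v)
  ... | yes (u , e) = cong latest (index-injective e)
  ... | no h = ⊥-elim (h (v , refl))

  open Placement par par-< par-pos

  2≤index : ∀ v → 2 ℕ.≤ index v
  2≤index v = s≤s (s≤s z≤n)

  -- Either u is the parent of v or, by `latest-Back`, a back neighbour of that parent, whose key is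
  -- smaller.
  Back⇒≼ : ∀ {u v} → Back u v → index u ≼ index v
  Back⇒≼ {u} {v} = go (suc (key v)) ℕ.≤-refl
    where
    go : ∀ n {v} → key v ℕ.< n → Back u v → index u ≼ index v
    go (suc n) {v} (s≤s k) h with latest-Back h
    ... | inj₁ e = up (2≤index v) (subst (index u ≼_) (trans e (sym (par-index v))) here)
    ... | inj₂ (w , e , h′) = up (2≤index v) (subst (index u ≼_) (trans e (sym (par-index v)))
      (go n (ℕ.<-≤-trans w<v k) h′))
      where
      w<v : key w ℕ.< key v
      w<v = ℕ.≤-pred (ℕ.≤-pred (subst (ℕ._< index v) (sym e) (latest< v)))

  -- The path from a down to b passes through c, and the back neighbours of a
  -- above its parent are back neighbours of its parent.
  Back-between : ∀ {a b c} → Back b a → index c ≼ index a → ¬ index c ≼ index b → Back b c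
  Back-between {a} {b} {c} h c≼a c⋠b = go c≼a refl h
    where
    go : ∀ {i a} → index c ≼ i → i ≡ index a → Back b a → Back b c
    go here e h = subst (Back b) (sym (index-injective e)) h
    go {a = a} (up _ c≼p) refl h with latest-Back h
    ... | inj₁ e = ⊥-elim (c⋠b (subst (index c ≼_) (trans (par-index a) (sym e)) c≼p))
    ... | inj₂ (w , e , h′) = go c≼p (trans (par-index a) (sym e)) h′

  at : V → Plane.Pt
  at v = position (index v)

  private
    index-≢ : ∀ {u v} → u ≢ v → index u ≢ index v
    index-≢ h e = h (index-injective e)

    0≢index : ∀ v → 0 ≢ index v
    0≢index v ()

  at-injective : ∀ {u v} → at u ≡ at v → u ≡ v
  at-injective {u} {v} e with u Fin.≟ v
  ... | yes u≡v = u≡v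
  -- Two coinciding points would be collinear with the auxiliary point of index 0.
  ... | no u≢v = ⊥-elim (position-general (0≢index u) (0≢index v) (index-≢ u≢v)
    (trans (cong (Plane.orient (position 0) (at u)) (sym e))
      (Plane.orient-abb (position 0) (at u))))

  module _ where
    open RealPlane

    no-three-edges : ∀ {a b c d e f : V} {p} → a ≢ b → c ≢ d → e ≢ f →
      Apart a b c d → Apart a b e f → Apart c d e f →
      OnLine (at a) (at b) p → OnLine (at c) (at d) p → OnLine (at e) (at f) p → ⊥
    no-three-edges {p = p} a≢b c≢d e≢f x y z = no-three
      (index-≢ a≢b) (index-≢ c≢d) (index-≢ e≢f) (index-apart x) (index-apart y) (index-apart z)
      where
      open NoThree (λ i j → OnLine (position i) (position j) p)
        (λ {i} {j} → OnLine-sym {position i} {position j} {p})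
        (λ {a} {b} {c} {d} {e} {f} h k l → concurrent⇒det≡0
          (Plane.line (position c) (position d)) (Plane.line (position e) (position f))
          (Plane.line (position a) (position b)) {p} k l h)
      index-apart : ∀ {a b c d : V} → Apart a b c d → Apart (index a) (index b) (index c) (index d)
      index-apart (p , q , r , s) = index-≢ p , index-≢ q , index-≢ r , index-≢ s

  open RationalDrawing G at at-injective
    (λ a≢b a≢c b≢c → position-general (index-≢ a≢b) (index-≢ a≢c) (index-≢ b≢c))
    (λ {p = p} → no-three-edges {p = p}) hiding (V)

  candidates : List (V × V × V × V)
  candidates = concatMap (λ v′ → concatMap (λ u′ → concatMap (λ u →
    map (λ v → v , u , v′ , u′) (filter (adj? u) (allFin (order G))))
    (backs u′)) (backs v′)) (allFin (order G))

  length-candidates : length candidates ℕ.≤ order G ℕ.* (width ℕ.* (width ℕ.* Δ G))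
  length-candidates = ℕ.≤-trans
    (length-concatMap _ (allFin (order G)) λ v′ → ℕ.≤-trans
      (length-concatMap _ (backs v′) λ u′ → ℕ.≤-trans
        (length-concatMap _ (backs u′) λ u → ℕ.≤-trans
          (ℕ.≤-reflexive (length-map _ (filter (adj? u) (allFin (order G)))))
          (≤-maximum (degree G) u))
        (ℕ.*-monoˡ-≤ (Δ G) (length-backs u′)))
      (ℕ.*-monoˡ-≤ (width ℕ.* Δ G) (length-backs v′)))
    (ℕ.≤-reflexive (cong (ℕ._* (width ℕ.* (width ℕ.* Δ G))) (length-tabulate {n = order G} id)))

  ∈-candidates : ∀ {v u v′ u′} → Adj u v → Back u u′ → Back u′ v′ → (v , u , v′ , u′) ∈ candidates
  ∈-candidates {v} {u} {v′} {u′} uv h k =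
    ∈-concatMap (∈-allFin v′) (∈-concatMap (∈-backs k) (∈-concatMap (∈-backs h)
      (∈-map⁺ _ (∈-filter⁺ (adj? u) (∈-allFin v) uv))))

  Covered : Point → Set
  Covered p = ∃[ a ] ∃[ b ] ∃[ c ] ∃[ d ] (CrossAt a b c d p × (a , b , c , d) ∈ candidates)

  opposite⇒¬same : ∀ {x y} → RealPlane.Opposite x y → ¬ Sign.Same y x
  opposite⇒¬same (inj₁ (h , _)) (inj₂ (_ , k)) = ℚ.<-asym h k
  opposite⇒¬same (inj₁ (_ , h)) (inj₁ (k , _)) = ℚ.<-asym h k
  opposite⇒¬same (inj₂ (h , _)) (inj₁ (_ , k)) = ℚ.<-asym h k
  opposite⇒¬same (inj₂ (_ , h)) (inj₂ (k , _)) = ℚ.<-asym h k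

  Back-≢ : ∀ {u v} → Back u v → index v ≢ index u
  Back-≢ (_ , h) e = ℕ.<-irrefl (ℕ.suc-injective (ℕ.suc-injective (sym e))) h

  back-crossing⇒≼ : ∀ {v u v′ u′ p} → Back u v → Back u′ v′ → CrossAt v u v′ u′ p →
    index u ≼ index v′
  back-crossing⇒≼ {v} {u} {v′} {u′} h h′ (crossAt (_ , _ , _ , o) _ _) =
    separated⇒≼ (ℕ.≤-trans (s≤s z≤n) (2≤index u)) (Back⇒≼ h) (Back⇒≼ h′) (Back-≢ h′)
      (λ s → opposite⇒¬same o (Sign.Same-sym s))

  crossing-ends-differ : ∀ {v u v′ u′ p} → CrossAt v u v′ u′ p → u ≢ u′
  crossing-ends-differ {v} {u} (crossAt (_ , _ , o , _) _ _) refl =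
    proj₂ (RealPlane.Opposite⇒≢0 o) (Plane.orient-abb (at v) (at u))

  -- On the path up from v, u′ comes strictly before u, as crossing edges share no end. So
  -- `Back-between` turns the back neighbour u of v into one of u′, and the pair of edges is a
  -- candidate.
  nested : ∀ {v u v′ u′ p} → Back u v → Back u′ v′ → CrossAt v u v′ u′ p →
    index u ≼ index u′ → index u′ ≼ index v → Covered p
  nested {v} {u} {v′} {u′} h h′ X u≼u′ u′≼v = _ , _ , _ , _ , X ,
    ∈-candidates (symm (proj₁ (CrossAt.cross-edges X)))
      (Back-between h u′≼v (λ u′≼u → crossing-ends-differ X
        (index-injective (ℕ.≤-antisym (≼⇒≤ u≼u′) (≼⇒≤ u′≼u))))) h′

  -- Each edge separates the ends of the other, so u and u′ are both ancestors of v and hence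
  -- comparable; the two outcomes differ by exchanging the edges.
  covered-back : ∀ {v u v′ u′ p} → Back u v → Back u′ v′ → CrossAt v u v′ u′ p → Covered p
  covered-back {v} {u} {v′} {u′} {p} h h′ X = split (≼-comparable (Back⇒≼ h) u′≼v)
    where
    u≼v′ : index u ≼ index v′
    u≼v′ = back-crossing⇒≼ h h′ X
    u′≼v : index u′ ≼ index v
    u′≼v = back-crossing⇒≼ h′ h (crossAt-swap X)
    split : index u ≼ index u′ ⊎ index u′ ≼ index u → Covered p
    split (inj₁ u≼u′) = nested h h′ X u≼u′ u′≼v
    split (inj₂ u′≼u) = nested h′ h (crossAt-swap X) u′≼u u≼v′

  covered : ∀ {a b c d p} → CrossAt a b c d p → Covered p
  covered {a} {b} {c} {d} {p} X@(crossAt (ab , cd , _) _ _) =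
    split (Back-adjacent ab) (Back-adjacent cd)
    where
    split : Back a b ⊎ Back b a → Back c d ⊎ Back d c → Covered p
    -- Each edge is turned so that its back neighbour comes second; the second edge is flipped
    -- between two exchanges of the edges.
    split (inj₂ h) (inj₂ k) = covered-back h k X
    split (inj₁ h) (inj₂ k) = covered-back h k (crossAt-flip X)
    split (inj₂ h) (inj₁ k) = covered-back h k (crossAt-swap (crossAt-flip (crossAt-swap X)))
    split (inj₁ h) (inj₁ k) =
      covered-back h k (crossAt-swap (crossAt-flip (crossAt-swap (crossAt-flip X))))

  crossing-number : cr̄ G ≤ order G ℕ.* (width ℕ.* (width ℕ.* Δ G))
  crossing-number = let (m , count , m≤) = crossing-number-bound candidates covered in
    drawing , m , count , ℕ.≤-trans m≤ length-candidates

open import Data.Nat.Base using (_*_; _>_)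

corollary10 : ∀ (k : ℕ) → k > 0 → ∃[ c ]
    (∀ (G : Graph) → treewidth G ≤ k → cr̄ G ≤ c * Δ G * order G)
corollary10 k _ = k * k , λ G (D , w≤k) →
  let (drawing , m , count , m≤) = TreewidthDrawing.crossing-number D in
  drawing , m , count , ℕ.≤-trans m≤ (bound (order G) (Δ G) w≤k)
  where
  bound : ∀ n d {w} → w ℕ.≤ k → n * (w * (w * d)) ℕ.≤ k * k * d * n
  bound n d {w} w≤k = begin
    n * (w * (w * d)) ≤⟨ ℕ.*-monoʳ-≤ n (ℕ.*-mono-≤ w≤k (ℕ.*-monoˡ-≤ d w≤k)) ⟩
    n * (k * (k * d)) ≡⟨ cong (n *_) (sym (ℕ.*-assoc k k d)) ⟩
    n * (k * k * d)   ≡⟨ ℕ.*-comm n (k * k * d) ⟩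
    k * k * d * n     ∎
    where open ℕ.≤-Reasoning
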